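{- For all integers $n>p\ge 0$, $$\sum_{k=p+1}^{n}\sum_{j=0}^{p}\binom{n}{k}{k\brace p+1}{p\brack j}(-1)^{j}B_{n+j-k}=\frac{p^{\,n-1}\,(n-pH_{p})}{p+1}+\frac{p!}{p+1}\sum_{j=1}^{p}{n\brace p-j}\frac{H_{j}}{j!}.$$
   Context: $B_m$ is the $m$th Bernoulli number, $\sum_{m\ge 0}B_m\frac{t^m}{m!}=\frac{t}{e^t-1}$ (so $B_1=-\tfrac12$). ${n\brace k}$ denotes the Stirling number of the second kind, i.e. $\sum_{n\ge 0}{n\brace k}\frac{t^n}{n!}=\frac{(e^t-1)^k}{k!}$. ${p\brack j}$ denotes the unsigned Stirling number of the first kind (the number of permutations of $p$ elements with exactly $j$ cycles, with ${0\brack 0}=1$). $H_n=\sum_{j=1}^{n}\frac1j$ is the $n$th harmonic number, with $H_0=0$; empty sums are $0$. The convention $0^0=1$ is used (relevant for $p=0$, $n=1$). -}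

module Defs where

import Algebra.Definitions.RawSemiring as RawSemiringDefinitions
import Algebra.Properties.Monoid.Sum as MonoidSum
open import Data.Fin.Base using (Fin; toℕ; fromℕ<; zero; suc)
import Data.Fin.Properties as Fin
open import Data.Fin.Permutation
  using (Permutation′; _⟨$⟩ʳ_; _≈_; id; _∘ₚ_; lift₀; remove; transpose; lift₀-remove; lift₀-cong)
import Data.Fin.Permutation.Components as Components
open import Data.Integer.Base using (+_)
import Data.Integer.Properties as ℤ
open import Data.List.Base using (List; []; _∷_; length; filter; deduplicate; allFin; cartesianProductWith)
open import Data.List.Membership.Propositional.Properties using (∈-allFin)
open import Data.List.Relation.Unary.All using ([])
open import Data.List.Relation.Unary.AllPairs using ([]; _∷_)
open import Data.List.Relation.Unary.Any using (Any; here)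
import Data.List.Relation.Unary.Any.Properties as Any
open import Data.List.Relation.Unary.Unique.Propositional.Properties using (allFin⁺)
import Data.List.Relation.Unary.Unique.Setoid as UniqueSetoid
import Data.List.Relation.Unary.Unique.Setoid.Properties as UniqueSetoid
open import Data.Nat.Base as ℕ using (ℕ; zero; suc; _∸_; _!)
import Data.Nat.DivMod as ℕ
open import Data.Nat.GeneralisedArithmetic using (iterate)
import Data.Nat.Properties as ℕ
open import Data.Product.Base using (∃; _×_; _,_)
open import Data.Rational.Base using (ℚ; 0ℚ; 1ℚ; NonZero; _/_; _+_; _*_; _-_; -_; _÷_; 1/_; toℚᵘ; +-*-rawSemiring)
import Data.Rational.Properties as ℚ
import Data.Rational.Unnormalised.Base as ℚᵘ
import Data.Rational.Unnormalised.Properties as ℚᵘ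
open import Function.Bundles using (Injection)
open import Function.Properties.Inverse using (↔⇒↣)
open import Level using (0ℓ)
open import Relation.Binary.Bundles using (Setoid)
open import Relation.Binary.PropositionalEquality
open import Relation.Nullary.Decidable using (Dec; map′; dec-true)

open MonoidSum ℚ.+-0-monoid using (sum-syntax; sum⁺-syntax; sum-cong-≗)
open RawSemiringDefinitions +-*-rawSemiring public using (_^_)

fromℕ : ℕ → ℚ
fromℕ n = + n / 1

infixl 7 _÷ℕ_ _÷!_

_÷ℕ_ : ℚ → (d : ℕ) → .{{ℕ.NonZero d}} → ℚ
q ÷ℕ d = q * (+ 1 / d)

_÷!_ : ℚ → ℕ → ℚ
q ÷! n = q ÷ℕ (n !)
  where instance _ = n ℕ.!≢0

-- Both bounds are inclusive; the sum is empty when b < a.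
∑-range : ℕ → ℕ → (ℕ → ℚ) → ℚ
∑-range a b f = ∑[ i < suc b ∸ a ] f (a ℕ.+ toℕ i)

infixr 10 ∑-range
syntax ∑-range a b (λ k → x) = ∑[ k from a to b ] x

harmonic : ℕ → ℚ
harmonic n = ∑[ i < n ] (+ 1 / suc (toℕ i))

-- Formal power series over ℚ, as sequences of coefficients.
Series : Set
Series = ℕ → ℚ

const : ℚ → Series
const c zero    = c
const c (suc n) = 0ℚ

X : Series
X zero    = 0ℚ
X (suc n) = const 1ℚ n

exp : Series
exp n = 1ℚ ÷! n

infixl 6 _⊖_
infixl 7 _⊛_ _⊘_
infixr 8 _^ˢ_

_⊖_ : Series → Series → Series
(f ⊖ g) n = f n - g n

scale : ℚ → Series → Series
scale c f n = c * f n

_⊛_ : Series → Series → Series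
(f ⊛ g) n = ∑[ i ≤ n ] (f (toℕ i) * g (n ∸ toℕ i))

_^ˢ_ : Series → ℕ → Series
f ^ˢ zero  = const 1ℚ
f ^ˢ suc k = f ⊛ f ^ˢ k

tail : Series → Series
tail f n = f (suc n)

-- Long division, for a divisor with invertible constant term: if f = g q and
-- q = c + t q′, then f₀ = c g₀ and (f - c g) / t = g q′.
_⊘_ : (f g : Series) → .{{NonZero (g 0)}} → Series
(f ⊘ g) zero    = f 0 ÷ g 0
(f ⊘ g) (suc n) = (tail (f ⊖ scale (f 0 ÷ g 0) g) ⊘ g) n

expm1 : Series
expm1 = exp ⊖ const 1ℚ

-- t / (eᵗ - 1), where the common factor t has to be cancelled first because
-- the divisor has no constant term.
bernoulliSeries : Series
bernoulliSeries = tail X ⊘ tail expm1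

-- egf a is the series ∑ aₙ tⁿ / n!, and coeff! recovers a from it.
egf : (ℕ → ℚ) → Series
egf a n = a n ÷! n

coeff! : Series → ℕ → ℚ
coeff! f n = fromℕ (n !) * f n

bernoulli : ℕ → ℚ
bernoulli = coeff! bernoulliSeries

stirling₂ : ℕ → ℕ → ℚ
stirling₂ n k = coeff! (scale (1ℚ ÷! k) (expm1 ^ˢ k)) n

open ≡-Reasoning

fromℕ-inverse : ∀ d .{{_ : ℕ.NonZero d}} → fromℕ d * (+ 1 / d) ≡ 1ℚ
fromℕ-inverse d@(suc d-1) = ℚ.toℚᵘ-injective
  (ℚᵘ.≃-trans (ℚ.toℚᵘ-homo-* (fromℕ d) (+ 1 / d))
  (ℚᵘ.≃-trans (ℚᵘ.*-cong (ℚ.toℚᵘ-fromℚᵘ (ℚᵘ.mkℚᵘ (+ d) 0)) (ℚ.toℚᵘ-fromℚᵘ (ℚᵘ.mkℚᵘ (+ 1) d-1)))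
  (ℚᵘ.*≡* (trans (ℤ.*-identityʳ _) (trans (ℤ.*-identityʳ (+ d)) (sym (trans (ℤ.*-identityˡ _) (ℤ.*-identityˡ (+ d)))))))))

egf-coeff! : ∀ f → egf (coeff! f) ≗ f
egf-coeff! f n = begin
  fromℕ (n !) * f n * (+ 1 / n !)    ≡⟨ cong (_* (+ 1 / n !)) (ℚ.*-comm (fromℕ (n !)) (f n)) ⟩
  f n * fromℕ (n !) * (+ 1 / n !)    ≡⟨ ℚ.*-assoc (f n) _ _ ⟩
  f n * (fromℕ (n !) * (+ 1 / n !))  ≡⟨ cong (f n *_) (fromℕ-inverse (n !)) ⟩
  f n * 1ℚ                           ≡⟨ ℚ.*-identityʳ (f n) ⟩
  f n                                ∎
  where instance _ = n ℕ.!≢0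

÷-* : ∀ p q .{{_ : NonZero q}} → p ÷ q * q ≡ p
÷-* p q = trans (ℚ.*-assoc p (1/ q) q) (trans (cong (p *_) (ℚ.*-inverseˡ q)) (ℚ.*-identityʳ p))

⊘-⊛ : ∀ f g .{{_ : NonZero (g 0)}} → (f ⊘ g) ⊛ g ≗ f
⊘-⊛ f g zero    = trans (ℚ.+-identityʳ _) (÷-* (f 0) (g 0))
⊘-⊛ f g (suc n) = begin
  c * g (suc n) + (f′ ⊘ g ⊛ g) n                 ≡⟨ cong (_+_ (c * g (suc n))) (⊘-⊛ f′ g n) ⟩
  c * g (suc n) + (f (suc n) - c * g (suc n))    ≡⟨ ℚ.+-assoc (c * g (suc n)) _ _ ⟨
  c * g (suc n) + f (suc n) - c * g (suc n)      ≡⟨ cong (_- c * g (suc n)) (ℚ.+-comm (c * g (suc n)) _) ⟩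
  f (suc n) + c * g (suc n) - c * g (suc n)      ≡⟨ ℚ.+-assoc (f (suc n)) _ _ ⟩
  f (suc n) + (c * g (suc n) - c * g (suc n))    ≡⟨ cong (_+_ (f (suc n))) (ℚ.+-inverseʳ (c * g (suc n))) ⟩
  f (suc n) + 0ℚ                                 ≡⟨ ℚ.+-identityʳ _ ⟩
  f (suc n)                                      ∎
  where
  c  = f 0 ÷ g 0
  f′ = tail (f ⊖ scale c g)

⊛-congˡ : ∀ {f f′} g → f ≗ f′ → f ⊛ g ≗ f′ ⊛ g
⊛-congˡ g f≗f′ n = sum-cong-≗ {suc n} λ i → cong (_* g (n ∸ toℕ i)) (f≗f′ (toℕ i))

⊛-tail : ∀ f g → g 0 ≡ 0ℚ → ∀ n → (f ⊛ g) (suc n) ≡ (f ⊛ tail g) n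
⊛-tail f g g₀≡0 zero    = cong (_+_ (f 0 * g 1)) (begin
  f 1 * g 0 + 0ℚ  ≡⟨ ℚ.+-identityʳ _ ⟩
  f 1 * g 0       ≡⟨ cong (f 1 *_) g₀≡0 ⟩
  f 1 * 0ℚ        ≡⟨ ℚ.*-zeroʳ (f 1) ⟩
  0ℚ              ∎)
⊛-tail f g g₀≡0 (suc n) = cong (_+_ (f 0 * g (2 ℕ.+ n))) (⊛-tail (tail f) g g₀≡0 n)

bernoulli-egf : egf bernoulli ⊛ expm1 ≗ X
bernoulli-egf zero    = refl
bernoulli-egf (suc n) = begin
  (egf bernoulli ⊛ expm1) (suc n)    ≡⟨ ⊛-congˡ expm1 (egf-coeff! bernoulliSeries) (suc n) ⟩
  (bernoulliSeries ⊛ expm1) (suc n)  ≡⟨ ⊛-tail bernoulliSeries expm1 refl n ⟩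
  (bernoulliSeries ⊛ tail expm1) n   ≡⟨ ⊘-⊛ (tail X) (tail expm1) n ⟩
  X (suc n)                          ∎

stirling₂-egf : ∀ k → egf (λ n → stirling₂ n k) ≗ scale (1ℚ ÷! k) (expm1 ^ˢ k)
stirling₂-egf k = egf-coeff! (scale (1ℚ ÷! k) (expm1 ^ˢ k))

-- Forward iteration suffices, since π has finite order.
SameCycle : ∀ {n} → Permutation′ n → Fin n → Fin n → Set
SameCycle π i j = ∃ λ k → iterate (π ⟨$⟩ʳ_) i k ≡ j

module _ {n} (π : Permutation′ n) where

  private
    step : Fin n → ℕ → Fin n
    step = iterate (π ⟨$⟩ʳ_)

  iterate-+ : ∀ i a b → step i (a ℕ.+ b) ≡ step (step i a) b
  iterate-+ i zero    b = refl
  iterate-+ i (suc a) b = iterate-+ (π ⟨$⟩ʳ i) a b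

  iterate-injective : ∀ {i j} k → step i k ≡ step j k → i ≡ j
  iterate-injective zero    eq = eq
  iterate-injective (suc k) eq = Injection.injective (↔⇒↣ π) (iterate-injective k eq)

  period : ∀ i → ∃ λ d → suc d ℕ.≤ n × step i (suc d) ≡ i
  period i with Fin.pigeonhole (ℕ.n<1+n n) (λ a → step i (toℕ a))
  ... | a , b , a<b , eq with ℕ.m≤n⇒∃[o]m+o≡n a<b
  ...   | d , 1+a+d≡b = d , 1+d≤n , sym (iterate-injective (toℕ a) eq′)
    where
    b≡1+d+a : toℕ b ≡ suc d ℕ.+ toℕ a
    b≡1+d+a = trans (sym 1+a+d≡b) (cong suc (ℕ.+-comm (toℕ a) d))

    1+d≤n : suc d ℕ.≤ n
    1+d≤n = ℕ.≤-trans (ℕ.m≤m+n (suc d) (toℕ a))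
      (subst (ℕ._≤ n) b≡1+d+a (ℕ.≤-pred (Fin.toℕ<n b)))

    eq′ : step i (toℕ a) ≡ step (step i (suc d)) (toℕ a)
    eq′ = trans eq (trans (cong (step i) b≡1+d+a) (iterate-+ i (suc d) (toℕ a)))

  iterate-* : ∀ {i d} → step i d ≡ i → ∀ q → step i (q ℕ.* d) ≡ i
  iterate-* {i} {d} eq zero    = refl
  iterate-* {i} {d} eq (suc q) = begin
    step i (d ℕ.+ q ℕ.* d)     ≡⟨ iterate-+ i d (q ℕ.* d) ⟩
    step (step i d) (q ℕ.* d)  ≡⟨ cong (λ x → step x (q ℕ.* d)) eq ⟩
    step i (q ℕ.* d)           ≡⟨ iterate-* eq q ⟩
    i                          ∎

  bounded : ∀ {i j} → SameCycle π i j → ∃ λ (k : Fin n) → step i (toℕ k) ≡ j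
  bounded {i} {j} (k , eq) with period i
  ... | d , 1+d≤n , eq′ = fromℕ< r<n , (begin
    step i (toℕ (fromℕ< r<n))  ≡⟨ cong (step i) (Fin.toℕ-fromℕ< r<n) ⟩
    step i r                                 ≡⟨ cong (λ x → step x r) (iterate-* eq′ q) ⟨
    step (step i (q ℕ.* suc d)) r            ≡⟨ iterate-+ i (q ℕ.* suc d) r ⟨
    step i (q ℕ.* suc d ℕ.+ r)               ≡⟨ cong (step i) (ℕ.+-comm (q ℕ.* suc d) r) ⟩
    step i (r ℕ.+ q ℕ.* suc d)               ≡⟨ cong (step i) (ℕ.m≡m%n+[m/n]*n k (suc d)) ⟨
    step i k                                 ≡⟨ eq ⟩
    j                                        ∎)
    where
    r q : ℕ
    r = k ℕ.% suc d
    q = k ℕ./ suc d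

    r<n : r ℕ.< n
    r<n = ℕ.<-≤-trans (ℕ.m%n<n k (suc d)) 1+d≤n

  SameCycle? : ∀ i j → Dec (SameCycle π i j)
  SameCycle? i j = map′ (λ (k , eq) → toℕ k , eq) bounded
    (Fin.any? λ k → step i (toℕ k) Fin.≟ j)

-- The number of classes of SameCycle: deduplicate keeps one point per class.
cycles : ∀ {n} → Permutation′ n → ℕ
cycles {n} π = length (deduplicate (SameCycle? π) (allFin n))

-- Every permutation of suc n points is uniquely a permutation fixing zero
-- followed by the transposition of zero with its image k.
permutations : ∀ n → List (Permutation′ n)
permutations zero    = id ∷ []
permutations (suc n) =
  cartesianProductWith (λ k π → lift₀ π ∘ₚ transpose zero k) (allFin (suc n)) (permutations n)

permutationSetoid : ℕ → Setoid 0ℓ 0ℓ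
permutationSetoid n = record
  { Carrier       = Permutation′ n
  ; _≈_           = _≈_
  ; isEquivalence = record
    { refl  = λ _ → refl
    ; sym   = λ p i → sym (p i)
    ; trans = λ p q i → trans (p i) (q i)
    }
  }

transpose-zero : ∀ {n} (k : Fin (suc n)) → Components.transpose k zero k ≡ zero
transpose-zero k rewrite dec-true (k Fin.≟ k) refl = refl

permutations-complete : ∀ {n} (π : Permutation′ n) → Any (π ≈_) (permutations n)
permutations-complete {zero}  π = here λ ()
permutations-complete {suc n} π =
  Any.cartesianProductWith⁺ _ combine (∈-allFin k) (permutations-complete (remove zero σ))
  where
  k = π ⟨$⟩ʳ zero
  σ = π ∘ₚ transpose k zero

  σ-zero : σ ⟨$⟩ʳ zero ≡ zero
  σ-zero = transpose-zero k

  combine : ∀ {l ρ} → k ≡ l → remove zero σ ≈ ρ → π ≈ lift₀ ρ ∘ₚ transpose zero l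
  combine {ρ = ρ} refl eq i = begin
    π ⟨$⟩ʳ i                                                        ≡⟨ Components.transpose-inverse zero k ⟨
    Components.transpose zero k (σ ⟨$⟩ʳ i)                          ≡⟨ cong (Components.transpose zero k) (lift₀-remove σ σ-zero i) ⟨
    Components.transpose zero k (lift₀ (remove zero σ) ⟨$⟩ʳ i)      ≡⟨ cong (Components.transpose zero k) (lift₀-cong (remove zero σ) ρ eq i) ⟩
    Components.transpose zero k (lift₀ ρ ⟨$⟩ʳ i)                    ∎

permutations-unique : ∀ n → UniqueSetoid.Unique (permutationSetoid n) (permutations n)
permutations-unique zero    = [] ∷ []
permutations-unique (suc n) = UniqueSetoid.cartesianProductWith⁺
  (setoid (Fin (suc n))) (permutationSetoid n) (permutationSetoid (suc n))
  _ (λ {k} {l} {π} {ρ} → separate {k} {l} {π} {ρ}) (allFin⁺ (suc n)) (permutations-unique n)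
  where
  separate : ∀ {k l π ρ} → lift₀ π ∘ₚ transpose zero k ≈ lift₀ ρ ∘ₚ transpose zero l → k ≡ l × π ≈ ρ
  separate {k} {l} {π} {ρ} eq with eq zero
  ... | refl = refl , λ i → Fin.suc-injective
    (Injection.injective (↔⇒↣ (transpose zero k)) (eq (suc i)))

stirling₁ : ℕ → ℕ → ℕ
stirling₁ n k = length (filter (λ π → cycles π ℕ.≟ k) (permutations n))

{-# OPTIONS --safe #-}
module Submission where

-- Put x = eᵗ - 1 and D = d/dt. The numbers ∑ⱼ s(p,j) (-1)ʲ B(m+j) are the coefficients of
-- b_p = (p-1-D) ⋯ (1-D)(-D) (t / x), because ∑ⱼ s(p,j) zʲ = z (z+1) ⋯ (z+p-1), so the left-hand
-- side is the coefficient of tⁿ/n! in x^(p+1)/(p+1)! · b_p. The recurrence b_(p+1) = (p - D) b_p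
-- and Leibniz' rule give x^(p+1) b_p = R_p, where
--   R_0 = t,   R_(p+1) = (p+1) eᵗ R_p - p! x^(p+1),   D R_p = p R_p + p! xᵖ,
-- and the recursion is solved by
--   R_p = p! (t - H_p) e^(pt) + p!² ∑ⱼ H_j/j! · x^(p-j)/(p-j)!,
-- whose coefficients are the right-hand side.

open import Defs
open import Algebra.Bundles using (CommutativeRing; CommutativeSemiring)
import Algebra.Properties.Group as GroupProperties
import Algebra.Solver.Ring.NaturalCoefficients.Default as SemiringSolver
import Algebra.Structures.Biased as Biased
open import Data.Bool.Base using (true; false)
open import Data.Fin.Base using (Fin; zero; suc; toℕ)
open import Data.Fin.Permutation using (Permutation′; _⟨$⟩ʳ_; _∘ₚ_; lift₀; transpose)
import Data.Fin.Properties as Fin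
import Data.Integer.Base as ℤ
import Data.Integer.Properties as ℤ
open import Data.List.Base using (List; []; _∷_; _++_; length; map; filter; deduplicate; allFin; tabulate; cartesianProductWith)
open import Data.List.Membership.Propositional.Properties using (∈-allFin)
import Data.List.Properties as List
import Data.List.Relation.Unary.All as All
import Data.List.Relation.Unary.All.Properties as All
open import Data.List.Relation.Unary.Any as Any using (Any; here; there)
import Data.List.Relation.Unary.Any.Properties as Any
open import Data.Nat.Base as ℕ using (ℕ; zero; suc; _∸_; _<_; _≤_; _!) renaming (_+_ to _+ℕ_; _*_ to _*ℕ_; _^_ to _^ℕ_)
open import Data.Nat.Combinatorics using (_C_; nCk≡n!/k![n-k]!)
open import Data.Nat.Combinatorics.Specification using ([n∸k]!k!∣n!)
import Data.Nat.Divisibility as ℕ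
import Data.Nat.DivMod as ℕ
open import Data.Nat.GeneralisedArithmetic using (iterate)
import Data.Nat.Properties as ℕ
open import Data.Product.Base using (_,_)
open import Data.Rational.Base using (ℚ; 0ℚ; 1ℚ; _/_; _+_; _*_; _-_; -_; toℚᵘ)
import Data.Rational.Properties as ℚ
open import Data.Rational.Solver using (module +-*-Solver)
import Data.Rational.Unnormalised.Base as ℚᵘ
import Data.Rational.Unnormalised.Properties as ℚᵘ
open import Function.Base using (_∘_; id)
open import Level using (0ℓ)
open import Relation.Binary.Bundles using (Setoid)
open import Relation.Binary.Core using (Rel)
open import Relation.Binary.Definitions using (Symmetric; Transitive; Decidable)
open import Relation.Binary.PropositionalEquality
  using (_≡_; _≢_; _≗_; refl; sym; trans; cong; cong₂; subst; _→-setoid_; module ≡-Reasoning)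
import Relation.Binary.Reasoning.Setoid as SetoidReasoning
open import Relation.Nullary using (¬_; yes; no; does; contradiction)
open import Relation.Nullary.Decidable using (Dec; ¬?; dec-true; dec-false)
open import Relation.Unary using (Pred; _⊆_) renaming (Decidable to Decidable₁)
open import Algebra.Properties.Semiring.Sum (CommutativeRing.semiring ℚ.+-*-commutativeRing)
  using (sum-syntax; sum⁺-syntax; sum-cong-≗; sum-replicate-zero; ∑-distrib-+; *-distribˡ-sum)

-- Semiring identities

-- The differential equation for R_p keeps D out of the recursion: Leibniz' rule gives x^(p+2)
-- b_(p+1) = x (p R_p - D R_p) + (p+1) eᵗ R_p, and the bracket collapses to -p! xᵖ. Dividing the
-- recursion by (p+1)! e^((p+1)t) shows where it leads: R_p / (p! e^(pt)) is t minus the sum of (1 -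
-- e^(-t))ᵏ / k over 1 ≤ k ≤ p, a remainder of the logarithm series of t. The theorem needs this
-- expanded in powers of x instead. A second variable z serves that purpose: ∑ⱼ H_j/j! ·
-- x^(p-j)/(p-j)! is the coefficient of zᵖ in (∑ⱼ H_j zʲ/j!) e^(zx), and differential equations in z
-- become recurrences in p.

-- In the header's notation P = p+1, N = p, F = p!, e = eᵗ, E = e^(pt) and Y = xᵖ; a prime marks the
-- value at p+1. Subtractions are moved to the other side, so that a semiring solver applies.
module _ (S : CommutativeSemiring 0ℓ 0ℓ) where
  open CommutativeSemiring S renaming (refl to ≈-refl; sym to ≈-sym; trans to ≈-trans; _+_ to infixl 6 _∔_; _*_ to infixl 7 _∙_)
  open SetoidReasoning setoid renaming (begin_ to begin-≈_; _∎ to _∎-≈)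
  open SemiringSolver S using (solve; _:+_; _:*_; _:=_; con)

  -- `T`, left over by the recurrence of the harmonic convolution `W`, and the power `X` add up to
  -- e^((p+1)t). Since `c` is 1/(p+1), that is the term by which `M′` falls short of `M`.
  closedForm-identity : ∀ {P F E M M′ c e X W W′ T} →
    P ∙ W′ ≈ e ∙ W ∔ T → P ∙ F ∙ T ∔ X ≈ e ∙ E → M ≈ M′ ∔ c → P ∙ c ≈ 1# →
    P ∙ F ∙ (M′ ∙ (e ∙ E)) ∔ P ∙ F ∙ (P ∙ F) ∙ W′ ∔ F ∙ X ≈ P ∙ (e ∙ (F ∙ (M ∙ E) ∔ F ∙ F ∙ W))
  closedForm-identity {P} {F} {E} {M} {M′} {c} {e} {X} {W} {W′} {T} PW′ PFT M≈ Pc = begin-≈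
    P ∙ F ∙ (M′ ∙ (e ∙ E)) ∔ P ∙ F ∙ (P ∙ F) ∙ W′ ∔ F ∙ X
      ≈⟨ solve 7 (λ P F M′ e E W′ X → P :* F :* (M′ :* (e :* E)) :+ P :* F :* (P :* F) :* W′ :+ F :* X
           := P :* F :* (M′ :* (e :* E)) :+ P :* F :* F :* (P :* W′) :+ F :* X) ≈-refl P F M′ e E W′ X ⟩
    P ∙ F ∙ (M′ ∙ (e ∙ E)) ∔ P ∙ F ∙ F ∙ (P ∙ W′) ∔ F ∙ X
      ≈⟨ +-congʳ (+-congˡ (*-congˡ PW′)) ⟩
    P ∙ F ∙ (M′ ∙ (e ∙ E)) ∔ P ∙ F ∙ F ∙ (e ∙ W ∔ T) ∔ F ∙ X
      ≈⟨ solve 8 (λ P F M′ e E W T X → P :* F :* (M′ :* (e :* E)) :+ P :* F :* F :* (e :* W :+ T) :+ F :* X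
           := P :* F :* (M′ :* (e :* E)) :+ P :* F :* F :* (e :* W) :+ F :* (P :* F :* T :+ X)) ≈-refl P F M′ e E W T X ⟩
    P ∙ F ∙ (M′ ∙ (e ∙ E)) ∔ P ∙ F ∙ F ∙ (e ∙ W) ∔ F ∙ (P ∙ F ∙ T ∔ X)
      ≈⟨ +-congˡ (*-congˡ (≈-trans PFT (≈-trans (≈-sym (*-identityˡ (e ∙ E))) (*-congʳ (≈-sym Pc))))) ⟩
    P ∙ F ∙ (M′ ∙ (e ∙ E)) ∔ P ∙ F ∙ F ∙ (e ∙ W) ∔ F ∙ (P ∙ c ∙ (e ∙ E))
      ≈⟨ solve 7 (λ P F M′ c e E W → P :* F :* (M′ :* (e :* E)) :+ P :* F :* F :* (e :* W) :+ F :* (P :* c :* (e :* E))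
           := P :* (e :* (F :* ((M′ :+ c) :* E) :+ F :* F :* W))) ≈-refl P F M′ c e E W ⟩
    P ∙ (e ∙ (F ∙ ((M′ ∔ c) ∙ E) ∔ F ∙ F ∙ W))
      ≈⟨ *-congˡ (*-congˡ (+-congʳ (*-congˡ (*-congʳ M≈)))) ⟨
    P ∙ (e ∙ (F ∙ (M ∙ E) ∔ F ∙ F ∙ W)) ∎-≈

  -- Induction step for D R_p, by differentiating the recursion. `F ∙ (P ∙ (Y ∙ e))` is the
  -- derivative of p! x^(p+1); it stays on both sides until it can be cancelled.
  derivative-identity : ∀ {P F e X Y N R R′ DR DR′} →
    P ≈ 1# ∔ N → R′ ∔ F ∙ X ≈ P ∙ (e ∙ R) → DR ≈ N ∙ R ∔ F ∙ Y →
    DR′ ∔ F ∙ (P ∙ (Y ∙ e)) ≈ P ∙ (e ∙ R ∔ e ∙ DR) →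
    DR′ ∔ F ∙ (P ∙ (Y ∙ e)) ≈ P ∙ R′ ∔ P ∙ F ∙ X ∔ F ∙ (P ∙ (Y ∙ e))
  derivative-identity {P} {F} {e} {X} {Y} {N} {R} {R′} {DR} {DR′} P≈ rec DR≈ DR′≈ = begin-≈
    DR′ ∔ F ∙ (P ∙ (Y ∙ e))                  ≈⟨ DR′≈ ⟩
    P ∙ (e ∙ R ∔ e ∙ DR)                     ≈⟨ *-congˡ (+-congˡ (*-congˡ DR≈)) ⟩
    P ∙ (e ∙ R ∔ e ∙ (N ∙ R ∔ F ∙ Y))
      ≈⟨ solve 6 (λ P F e Y N R → P :* (e :* R :+ e :* (N :* R :+ F :* Y))
           := P :* ((con 1 :+ N) :* (e :* R)) :+ F :* (P :* (Y :* e))) ≈-refl P F e Y N R ⟩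
    -- The product rule contributes one `e ∙ R` and the differential equation `N` more, just enough
    -- to read the recursion backwards.
    P ∙ ((1# ∔ N) ∙ (e ∙ R)) ∔ F ∙ (P ∙ (Y ∙ e))  ≈⟨ +-congʳ (*-congˡ (≈-trans (*-congʳ (≈-sym P≈)) (≈-sym rec))) ⟩
    P ∙ (R′ ∔ F ∙ X) ∔ F ∙ (P ∙ (Y ∙ e))
      ≈⟨ solve 6 (λ P F X Y e R′ → P :* (R′ :+ F :* X) :+ F :* (P :* (Y :* e))
           := P :* R′ :+ P :* F :* X :+ F :* (P :* (Y :* e))) ≈-refl P F X Y e R′ ⟩
    P ∙ R′ ∔ P ∙ F ∙ X ∔ F ∙ (P ∙ (Y ∙ e))   ∎-≈

  -- Induction step for x^(p+1) b_p = R_p. It evaluates x · D R_p twice, by the differential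
  -- equation and by Leibniz' rule. The summand common to both sides collects the terms that would
  -- otherwise be subtracted.
  product-identity : ∀ {P F e x Y N R R′ DR b b′ Db} →
    R′ ∔ F ∙ (x ∙ Y) ≈ P ∙ (e ∙ R) → DR ≈ N ∙ R ∔ F ∙ Y → b′ ∔ Db ≈ N ∙ b →
    x ∙ Y ∙ b ≈ R → P ∙ (Y ∙ e) ∙ b ∔ x ∙ Y ∙ Db ≈ DR →
    x ∙ (x ∙ Y) ∙ b′ ∔ (x ∙ (x ∙ Y) ∙ Db ∔ F ∙ (x ∙ Y)) ≈ R′ ∔ (x ∙ (x ∙ Y) ∙ Db ∔ F ∙ (x ∙ Y))
  product-identity {P} {F} {e} {x} {Y} {N} {R} {R′} {DR} {b} {b′} {Db} rec DR≈ b′≈ xYb DxYb = begin-≈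
    x ∙ (x ∙ Y) ∙ b′ ∔ (x ∙ (x ∙ Y) ∙ Db ∔ F ∙ (x ∙ Y))
      ≈⟨ solve 5 (λ x Y F b′ Db → x :* (x :* Y) :* b′ :+ (x :* (x :* Y) :* Db :+ F :* (x :* Y))
           := x :* (x :* Y) :* (b′ :+ Db) :+ F :* (x :* Y)) ≈-refl x Y F b′ Db ⟩
    x ∙ (x ∙ Y) ∙ (b′ ∔ Db) ∔ F ∙ (x ∙ Y)
      ≈⟨ +-congʳ (*-congˡ b′≈) ⟩
    x ∙ (x ∙ Y) ∙ (N ∙ b) ∔ F ∙ (x ∙ Y)
      ≈⟨ solve 5 (λ x Y N b F → x :* (x :* Y) :* (N :* b) :+ F :* (x :* Y)
           := x :* (N :* (x :* Y :* b) :+ F :* Y)) ≈-refl x Y N b F ⟩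
    x ∙ (N ∙ (x ∙ Y ∙ b) ∔ F ∙ Y)
      ≈⟨ *-congˡ (+-congʳ (*-congˡ xYb)) ⟩
    x ∙ (N ∙ R ∔ F ∙ Y)
      ≈⟨ *-congˡ (≈-trans (≈-sym DR≈) (≈-sym DxYb)) ⟩
    x ∙ (P ∙ (Y ∙ e) ∙ b ∔ x ∙ Y ∙ Db)
      ≈⟨ solve 6 (λ x Y P e b Db → x :* (P :* (Y :* e) :* b :+ x :* Y :* Db)
           := P :* (e :* (x :* Y :* b)) :+ x :* (x :* Y) :* Db) ≈-refl x Y P e b Db ⟩
    P ∙ (e ∙ (x ∙ Y ∙ b)) ∔ x ∙ (x ∙ Y) ∙ Db
      ≈⟨ +-congʳ (≈-trans (*-congˡ (*-congˡ xYb)) (≈-sym rec)) ⟩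
    R′ ∔ F ∙ (x ∙ Y) ∔ x ∙ (x ∙ Y) ∙ Db
      ≈⟨ solve 3 (λ a u v → a :+ u :+ v := a :+ (v :+ u)) ≈-refl R′ (F ∙ (x ∙ Y)) (x ∙ (x ∙ Y) ∙ Db) ⟩
    R′ ∔ (x ∙ (x ∙ Y) ∙ Db ∔ F ∙ (x ∙ Y)) ∎-≈

  power-identity : ∀ f f′ F N → f′ ∙ (f ∙ F) ∔ f ∙ (N ∙ (F ∙ f′)) ≈ (1# ∔ N) ∙ (f ∙ F ∙ f′)
  power-identity = solve 4 (λ f f′ F N → f′ :* (f :* F) :+ f :* (N :* (F :* f′))
    := (con 1 :+ N) :* (f :* F :* f′)) ≈-refl

open +-*-Solver using (solve; _:+_; _:-_; _:*_; :-_; _:=_; con)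
open ≡-Reasoning

-- The recurrence of the Stirling numbers of the first kind

private
  variable
    A B : Set

-- Filtering and deduplicating lists

module _ {P : Pred A 0ℓ} (P? : Decidable₁ P) where

  filter-map : ∀ (f : B → A) xs → filter P? (map f xs) ≡ map f (filter (P? ∘ f) xs)
  filter-map f []       = refl
  filter-map f (x ∷ xs) with does (P? (f x))
  ... | true  = cong (f x ∷_) (filter-map f xs)
  ... | false = filter-map f xs

  length-filter-map : ∀ (f : B → A) xs → length (filter P? (map f xs)) ≡ length (filter (P? ∘ f) xs)
  length-filter-map f xs = trans (cong length (filter-map f xs)) (List.length-map f (filter (P? ∘ f) xs))

  length-filter-¬ : ∀ xs → length (filter P? xs) +ℕ length (filter (¬? ∘ P?) xs) ≡ length xs
  length-filter-¬ []       = refl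
  length-filter-¬ (x ∷ xs) with does (P? x)
  ... | true  = cong suc (length-filter-¬ xs)
  ... | false = trans (ℕ.+-suc _ _) (cong suc (length-filter-¬ xs))

  filter-⊆ : ∀ {Q : Pred A 0ℓ} (Q? : Decidable₁ Q) → P ⊆ Q → ∀ xs → filter P? (filter Q? xs) ≡ filter P? xs
  filter-⊆ Q? P⊆Q []       = refl
  filter-⊆ Q? P⊆Q (x ∷ xs) with Q? x
  ... | no ¬q = trans (filter-⊆ Q? P⊆Q xs) (sym (List.filter-reject P? (¬q ∘ P⊆Q)))
  ... | yes _ with does (P? x)
  ...   | true  = cong (x ∷_) (filter-⊆ Q? P⊆Q xs)
  ...   | false = filter-⊆ Q? P⊆Q xs

deduplicate-map : {R : Rel A 0ℓ} {S : Rel B 0ℓ} (R? : Decidable R) (S? : Decidable S) (f : A → B) →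
  (∀ {x y} → R x y → S (f x) (f y)) → (∀ {x y} → S (f x) (f y) → R x y) →
  ∀ xs → deduplicate S? (map f xs) ≡ map f (deduplicate R? xs)
deduplicate-map R? S? f R⇒S S⇒R []       = refl
deduplicate-map R? S? f R⇒S S⇒R (x ∷ xs) = cong (f x ∷_) (begin
  filter (¬? ∘ S? (f x)) (deduplicate S? (map f xs))  ≡⟨ cong (filter _) (deduplicate-map R? S? f R⇒S S⇒R xs) ⟩
  filter (¬? ∘ S? (f x)) (map f (deduplicate R? xs))  ≡⟨ filter-map (¬? ∘ S? (f x)) f (deduplicate R? xs) ⟩
  map f (filter (¬? ∘ S? (f x) ∘ f) (deduplicate R? xs))
    ≡⟨ cong (map f) (List.filter-≐ _ _ ((λ ¬s → ¬s ∘ R⇒S) , (λ ¬r → ¬r ∘ S⇒R)) (deduplicate R? xs)) ⟩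
  map f (filter (¬? ∘ R? x) (deduplicate R? xs))      ∎)

module _ {R : Rel A 0ℓ} (R? : Decidable R) (R-sym : Symmetric R) (R-trans : Transitive R) where

  -- If the head lies in the class of `k`, its own filter has removed every other member of that
  -- class. Otherwise that filter does not touch the class, and the induction hypothesis applies.
  unique-representative : ∀ {k xs} → Any (R k) xs → length (filter (R? k) (deduplicate R? xs)) ≡ 1
  unique-representative {k} {x ∷ xs} any with R? k x
  ... | yes kx = cong suc (cong length (List.filter-none (R? k)
                   (All.map (λ ¬xy ky → ¬xy (R-trans (R-sym kx) ky)) (All.all-filter (¬? ∘ R? x) (deduplicate R? xs)))))
  unique-representative {k} {x ∷ xs} (here kx) | no ¬kx = contradiction kx ¬kx
  unique-representative {k} {x ∷ xs} (there any) | no ¬kx = trans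
    (cong length (filter-⊆ (R? k) (¬? ∘ R? x) (λ ky xy → ¬kx (R-trans ky (R-sym xy))) (deduplicate R? xs)))
    (unique-representative any)

  -- The new head evicts exactly one element, the former representative of its class, and takes its
  -- place.
  length-deduplicate-∷ : ∀ {k xs} → Any (R k) xs → length (deduplicate R? (k ∷ xs)) ≡ length (deduplicate R? xs)
  length-deduplicate-∷ {k} {xs} any = trans
    (cong (ℕ._+ length (filter (¬? ∘ R? k) (deduplicate R? xs))) (sym (unique-representative any)))
    (length-filter-¬ (R? k) (deduplicate R? xs))

-- Cycles of a permutation with one point inserted

module _ {n} (π : Permutation′ n) where

  SameCycle-trans : Transitive (SameCycle π)
  SameCycle-trans {i} (k , refl) (l , eq) = k +ℕ l , trans (iterate-+ π i k l) eq

  SameCycle-sym : Symmetric (SameCycle π)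
  SameCycle-sym {i} (k , refl) with period π i
  -- `suc d` is a period of `i`, so `k *ℕ d` steps after the first `k` complete `k` full periods.
  ... | d , _ , eq = k *ℕ d , (begin
    iterate (π ⟨$⟩ʳ_) (iterate (π ⟨$⟩ʳ_) i k) (k *ℕ d)  ≡⟨ iterate-+ π i k (k *ℕ d) ⟨
    iterate (π ⟨$⟩ʳ_) i (k +ℕ k *ℕ d)                  ≡⟨ cong (iterate (π ⟨$⟩ʳ_) i) (ℕ.*-suc k d) ⟨
    iterate (π ⟨$⟩ʳ_) i (k *ℕ suc d)                    ≡⟨ iterate-* π eq k ⟩
    i                                                    ∎)

module _ {n} (π : Permutation′ n) where

  -- insert zero adds a fixed point; insert (suc k) puts zero in front of suc k in its cycle.
  insert : Fin (suc n) → Permutation′ (suc n)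
  insert k = lift₀ π ∘ₚ transpose zero k

  insert-hit : ∀ {k} i → π ⟨$⟩ʳ i ≡ k → insert (suc k) ⟨$⟩ʳ suc i ≡ zero
  insert-hit {k} i eq rewrite dec-true (π ⟨$⟩ʳ i Fin.≟ k) eq = refl

  insert-miss : ∀ {k} i → π ⟨$⟩ʳ i ≢ k → insert (suc k) ⟨$⟩ʳ suc i ≡ suc (π ⟨$⟩ʳ i)
  insert-miss {k} i ≢k rewrite dec-false (π ⟨$⟩ʳ i Fin.≟ k) ≢k = refl

  -- A step of `π` takes two steps of `insert k` when the new point lies on the way, and one step
  -- otherwise.
  insert-step : ∀ k i → SameCycle (insert k) (suc i) (suc (π ⟨$⟩ʳ i))
  insert-step zero    i = 1 , refl
  insert-step (suc k) i with π ⟨$⟩ʳ i Fin.≟ k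
  ... | yes refl = 2 , cong (insert (suc k) ⟨$⟩ʳ_) (insert-hit i refl)
  ... | no  ≢k   = 1 , insert-miss i ≢k

  SameCycle-insert⁺ : ∀ k {i j} → SameCycle π i j → SameCycle (insert k) (suc i) (suc j)
  SameCycle-insert⁺ k {i} (zero  , refl) = 0 , refl
  SameCycle-insert⁺ k {i} (suc m , eq)   =
    SameCycle-trans (insert k) (insert-step k i) (SameCycle-insert⁺ k (m , eq))

  -- A path of `insert k` between old points is contracted to a path of `π` by skipping each visit
  -- to `zero`. A visit uses up two steps at once, so the recursion is on the number of steps that
  -- remain.
  SameCycle-insert⁻ : ∀ k {i j} → SameCycle (insert k) (suc i) (suc j) → SameCycle π i j
  SameCycle-insert⁻ k (m , eq) = go k m eq
    where
    step : ∀ {i j} → SameCycle π (π ⟨$⟩ʳ i) j → SameCycle π i j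
    step (m , eq) = suc m , eq

    next : ∀ k x {y j} m → insert k ⟨$⟩ʳ x ≡ y →
      iterate (insert k ⟨$⟩ʳ_) x (suc m) ≡ j → iterate (insert k ⟨$⟩ʳ_) y m ≡ j
    next k x m refl eq = eq

    go : ∀ k {i j} m → iterate (insert k ⟨$⟩ʳ_) (suc i) m ≡ suc j → SameCycle π i j
    go′ : ∀ k {i j} m → Dec (π ⟨$⟩ʳ i ≡ k) → iterate (insert (suc k) ⟨$⟩ʳ_) (suc i) (suc m) ≡ suc j → SameCycle π i j

    go k       zero    eq = 0 , Fin.suc-injective eq
    go zero    (suc m) eq = step (go zero m eq)
    go (suc k) {i} (suc m) eq = go′ k m (π ⟨$⟩ʳ i Fin.≟ k) eq

    go′ k {i} m       (no ≢k)    eq = step (go (suc k) m (next (suc k) (suc i) m (insert-miss i ≢k) eq))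
    -- Such a path would end at the inserted point, whereas its target is a successor.
    go′ k {i} zero    (yes refl) eq = contradiction (next (suc k) (suc i) 0 (insert-hit i refl) eq) λ ()
    -- After `zero` comes `suc k`, and `k` is the image of `i`: the two steps amount to one step of
    -- `π`.
    go′ k {i} (suc m) (yes refl) eq = step (go (suc k) m (next (suc k) (suc i) (suc m) (insert-hit i refl) eq))

  private
    old : List (Fin (suc n))
    old = tabulate suc

    length-old : ∀ k → length (deduplicate (SameCycle? (insert k)) old) ≡ cycles π
    length-old k = begin
      length (deduplicate (SameCycle? (insert k)) old)
        ≡⟨ cong (length ∘ deduplicate (SameCycle? (insert k))) (List.map-tabulate id suc) ⟨
      length (deduplicate (SameCycle? (insert k)) (map suc (allFin n)))
        ≡⟨ cong length (deduplicate-map (SameCycle? π) (SameCycle? (insert k)) suc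
             (SameCycle-insert⁺ k) (SameCycle-insert⁻ k) (allFin n)) ⟩
      length (map suc (deduplicate (SameCycle? π) (allFin n)))
        ≡⟨ List.length-map suc (deduplicate (SameCycle? π) (allFin n)) ⟩
      cycles π ∎

    fixed : ∀ m → iterate (insert zero ⟨$⟩ʳ_) zero m ≡ zero
    fixed zero    = refl
    fixed (suc m) = fixed m

    separate : ∀ {i} → ¬ SameCycle (insert zero) zero (suc i)
    separate (m , eq) = contradiction (trans (sym (fixed m)) eq) λ ()

  cycles-insert-zero : cycles (insert zero) ≡ suc (cycles π)
  cycles-insert-zero = cong suc (trans
    (cong length (List.filter-all (¬? ∘ SameCycle? (insert zero) zero)
      (All.deduplicate⁺ (SameCycle? (insert zero)) (All.tabulate⁺ {f = suc} λ i → separate))))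
    (length-old zero))

  -- The point `zero` is mapped to the old point `suc k`, so putting it in front of the old points
  -- creates no new class.
  cycles-insert-suc : ∀ k → cycles (insert (suc k)) ≡ cycles π
  cycles-insert-suc k = trans
    (length-deduplicate-∷ (SameCycle? σ) (SameCycle-sym σ) (SameCycle-trans σ)
      (subst (Any _) (List.map-tabulate id suc) (Any.map⁺ (Any.map (λ { refl → 1 , refl }) (∈-allFin k)))))
    (length-old (suc k))
    where
    σ = insert (suc k)

-- Counting permutations by their number of cycles

count : (ℕ → ℕ) → ℕ → ℕ → ℕ
count g n j = length (filter (λ π → g (cycles π) ℕ.≟ j) (permutations n))

private
  -- For the list of all positions this unfolds to `permutations (suc n)`. An arbitrary list allows
  -- the positions to be split off one at a time.
  insertions : ∀ {n} → List (Fin (suc n)) → List (Permutation′ (suc n))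
  insertions {n} ks = cartesianProductWith (λ k π → insert π k) ks (permutations n)

length-filter-insert : ∀ n j k g → (∀ (π : Permutation′ n) → cycles (insert π k) ≡ g (cycles π)) →
  length (filter (λ π → cycles π ℕ.≟ j) (map (λ π → insert π k) (permutations n))) ≡ count g n j
length-filter-insert n j k g eq = trans
  (length-filter-map (λ π → cycles π ℕ.≟ j) (λ π → insert π k) (permutations n))
  (cong length (List.filter-≐ (λ π → cycles (insert π k) ℕ.≟ j) (λ π → g (cycles π) ℕ.≟ j)
    ((λ {π} → trans (sym (eq π))) , (λ {π} → trans (eq π))) (permutations n)))

length-filter-insert-++ : ∀ n j k ks g → (∀ (π : Permutation′ n) → cycles (insert π k) ≡ g (cycles π)) →
  length (filter (λ π → cycles π ℕ.≟ j) (insertions {n} (k ∷ ks)))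
    ≡ count g n j +ℕ length (filter (λ π → cycles π ℕ.≟ j) (insertions ks))
length-filter-insert-++ n j k ks g eq = begin
  length (filter P? (map f (permutations n) ++ insertions ks))
    ≡⟨ cong length (List.filter-++ P? (map f (permutations n)) (insertions ks)) ⟩
  length (filter P? (map f (permutations n)) ++ filter P? (insertions ks))
    ≡⟨ List.length-++ (filter P? (map f (permutations n))) ⟩
  length (filter P? (map f (permutations n))) +ℕ length (filter P? (insertions ks))
    ≡⟨ cong (ℕ._+ length (filter P? (insertions ks))) (length-filter-insert n j k g eq) ⟩
  count g n j +ℕ length (filter P? (insertions ks)) ∎
  where
  P? = λ π → cycles π ℕ.≟ j
  f  = λ π → insert π k

-- The map `f` separates the number of positions still to be treated, on which the induction runs,
-- from the fixed size `n`. At `f = id` these are all positions that leave the number of cycles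
-- unchanged.
length-filter-insert-suc : ∀ {m} n j (f : Fin m → Fin n) →
  length (filter (λ π → cycles π ℕ.≟ j) (insertions {n} (tabulate (λ i → suc (f i))))) ≡ m *ℕ stirling₁ n j
length-filter-insert-suc {zero}  n j f = refl
length-filter-insert-suc {suc m} n j f = trans
  (length-filter-insert-++ n j (suc (f zero)) (tabulate (λ i → suc (f (suc i)))) id (λ π → cycles-insert-suc π (f zero)))
  (cong (stirling₁ n j ℕ.+_) (length-filter-insert-suc n j (f ∘ suc)))

stirling₁-insert : ∀ n j → stirling₁ (suc n) j ≡ count suc n j +ℕ n *ℕ stirling₁ n j
stirling₁-insert n j = trans
  (length-filter-insert-++ n j zero (tabulate suc) suc cycles-insert-zero)
  (cong (count suc n j ℕ.+_) (length-filter-insert-suc n j id))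

stirling₁-zero : ∀ n → stirling₁ (suc n) 0 ≡ n *ℕ stirling₁ n 0
stirling₁-zero n = trans (stirling₁-insert n 0)
  (cong (ℕ._+ n *ℕ stirling₁ n 0)
    (cong length (List.filter-none (λ π → suc (cycles π) ℕ.≟ 0) (All.universal (λ _ ()) (permutations n)))))

stirling₁-suc : ∀ n j → stirling₁ (suc n) (suc j) ≡ stirling₁ n j +ℕ n *ℕ stirling₁ n (suc j)
stirling₁-suc n j = trans (stirling₁-insert n (suc j))
  (cong (ℕ._+ n *ℕ stirling₁ n (suc j))
    (cong length (List.filter-≐ (λ π → suc (cycles π) ℕ.≟ suc j) (λ π → cycles π ℕ.≟ j)
      ((λ {π} → ℕ.suc-injective) , (λ {π} → cong suc)) (permutations n))))

stirling₁-> : ∀ n j → n < j → stirling₁ n j ≡ 0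
stirling₁-> zero    (suc j) _         = refl
stirling₁-> (suc n) (suc j) (ℕ.s≤s n<j) = trans (stirling₁-suc n j)
  (cong₂ ℕ._+_ (stirling₁-> n j n<j)
    (trans (cong (n ℕ.*_) (stirling₁-> n (suc j) (ℕ.m<n⇒m<1+n n<j))) (ℕ.*-zeroʳ n)))

-- Formal power series

private
  toℚᵘ-fromℕ : ∀ n → toℚᵘ (fromℕ n) ℚᵘ.≃ ℚᵘ.mkℚᵘ (ℤ.+ n) 0
  toℚᵘ-fromℕ n = ℚ.toℚᵘ-fromℚᵘ (ℚᵘ.mkℚᵘ (ℤ.+ n) 0)

fromℕ-+ : ∀ m n → fromℕ (m +ℕ n) ≡ fromℕ m + fromℕ n
fromℕ-+ m n = ℚ.toℚᵘ-injective
  (ℚᵘ.≃-trans (toℚᵘ-fromℕ (m +ℕ n))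
  (ℚᵘ.≃-trans (ℚᵘ.*≡* (cong (ℤ._* ℤ.+ 1) (sym (cong₂ ℤ._+_ (ℤ.*-identityʳ (ℤ.+ m)) (ℤ.*-identityʳ (ℤ.+ n))))))
  (ℚᵘ.≃-sym (ℚᵘ.≃-trans (ℚ.toℚᵘ-homo-+ (fromℕ m) (fromℕ n)) (ℚᵘ.+-cong (toℚᵘ-fromℕ m) (toℚᵘ-fromℕ n))))))

fromℕ-* : ∀ m n → fromℕ (m *ℕ n) ≡ fromℕ m * fromℕ n
fromℕ-* m n = ℚ.toℚᵘ-injective
  (ℚᵘ.≃-trans (toℚᵘ-fromℕ (m *ℕ n))
  (ℚᵘ.≃-trans (ℚᵘ.*≡* (cong (ℤ._* ℤ.+ 1) (ℤ.pos-* m n)))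
  (ℚᵘ.≃-sym (ℚᵘ.≃-trans (ℚ.toℚᵘ-homo-* (fromℕ m) (fromℕ n)) (ℚᵘ.*-cong (toℚᵘ-fromℕ m) (toℚᵘ-fromℕ n))))))

fromℕ-suc : ∀ n → fromℕ (suc n) ≡ 1ℚ + fromℕ n
fromℕ-suc = fromℕ-+ 1

invertible-cancelˡ : ∀ {a b x y} → b * a ≡ 1ℚ → a * x ≡ a * y → x ≡ y
invertible-cancelˡ {a} {b} {x} {y} ba≡1 ax≡ay = begin
  x            ≡⟨ ℚ.*-identityˡ x ⟨
  1ℚ * x       ≡⟨ cong (_* x) ba≡1 ⟨
  b * a * x    ≡⟨ ℚ.*-assoc b a x ⟩
  b * (a * x)  ≡⟨ cong (b *_) ax≡ay ⟩
  b * (a * y)  ≡⟨ ℚ.*-assoc b a y ⟨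
  b * a * y    ≡⟨ cong (_* y) ba≡1 ⟩
  1ℚ * y       ≡⟨ ℚ.*-identityˡ y ⟩
  y            ∎

fromℕ-cancelˡ : ∀ d .{{_ : ℕ.NonZero d}} {x y} → fromℕ d * x ≡ fromℕ d * y → x ≡ y
fromℕ-cancelˡ d = invertible-cancelˡ {b = ℤ.+ 1 / d} (trans (ℚ.*-comm (ℤ.+ 1 / d) (fromℕ d)) (fromℕ-inverse d))

÷!-exp : ∀ q n → q ÷! n ≡ q * exp n
÷!-exp q n = cong (q *_) (sym (ℚ.*-identityˡ (ℤ.+ 1 / n !)))
  where instance _ = n ℕ.!≢0

exp-inverse : ∀ n → fromℕ (n !) * exp n ≡ 1ℚ
exp-inverse n = trans (cong (fromℕ (n !) *_) (ℚ.*-identityˡ (ℤ.+ 1 / n !))) (fromℕ-inverse (n !))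
  where instance _ = n ℕ.!≢0

exp-suc : ∀ n → fromℕ (suc n) * exp (suc n) ≡ exp n
exp-suc n = fromℕ-cancelˡ (n !) (begin
  fromℕ (n !) * (fromℕ (suc n) * exp (suc n))  ≡⟨ ℚ.*-assoc (fromℕ (n !)) (fromℕ (suc n)) (exp (suc n)) ⟨
  fromℕ (n !) * fromℕ (suc n) * exp (suc n)    ≡⟨ cong (_* exp (suc n)) (ℚ.*-comm (fromℕ (n !)) (fromℕ (suc n))) ⟩
  fromℕ (suc n) * fromℕ (n !) * exp (suc n)    ≡⟨ cong (_* exp (suc n)) (fromℕ-* (suc n) (n !)) ⟨
  fromℕ (suc n !) * exp (suc n)                ≡⟨ exp-inverse (suc n) ⟩
  1ℚ                                           ≡⟨ exp-inverse n ⟨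
  fromℕ (n !) * exp n                          ∎)
  where instance _ = n ℕ.!≢0

-- The commutative semiring of power series

infixl 6 _⊕_

_⊕_ : Series → Series → Series
(f ⊕ g) n = f n + g n

⊛-cong : ∀ {f f′ g g′} → f ≗ f′ → g ≗ g′ → f ⊛ g ≗ f′ ⊛ g′
⊛-cong f≗f′ g≗g′ n = sum-cong-≗ {suc n} λ i → cong₂ _*_ (f≗f′ (toℕ i)) (g≗g′ (n ∸ toℕ i))

-- By definition `(f ⊛ g) (suc n)` unfolds to `f 0 * g (suc n) + (tail f ⊛ g) n`. This and the
-- following inductions on the degree therefore pass to the tail of the left factor.
⊛-distribʳ : ∀ h f g → (f ⊕ g) ⊛ h ≗ f ⊛ h ⊕ g ⊛ h
⊛-distribʳ h f g zero = solve 4 (λ f₀ g₀ h₀ o → (f₀ :+ g₀) :* h₀ :+ (o :+ o) := f₀ :* h₀ :+ o :+ (g₀ :* h₀ :+ o))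
  refl (f 0) (g 0) (h 0) 0ℚ
⊛-distribʳ h f g (suc n) = trans (cong (_+_ ((f 0 + g 0) * h (suc n))) (⊛-distribʳ h (tail f) (tail g) n))
  (solve 5 (λ f₀ g₀ hₙ u v → (f₀ :+ g₀) :* hₙ :+ (u :+ v) := f₀ :* hₙ :+ u :+ (g₀ :* hₙ :+ v))
    refl (f 0) (g 0) (h (suc n)) ((tail f ⊛ h) n) ((tail g ⊛ h) n))

scale-⊛ : ∀ c f g → scale c f ⊛ g ≗ scale c (f ⊛ g)
scale-⊛ c f g n = begin
  ∑[ i ≤ n ] (c * f (toℕ i) * g (n ∸ toℕ i))    ≡⟨ sum-cong-≗ {suc n} (λ i → ℚ.*-assoc c (f (toℕ i)) (g (n ∸ toℕ i))) ⟩
  ∑[ i ≤ n ] (c * (f (toℕ i) * g (n ∸ toℕ i)))  ≡⟨ *-distribˡ-sum c (λ (i : Fin (suc n)) → f (toℕ i) * g (n ∸ toℕ i)) ⟨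
  c * (f ⊛ g) n                                 ∎

-- The mirror image of the definitional unfolding, splitting off the last summand instead of the
-- first; together the two yield commutativity.
⊛-suc : ∀ f g n → (f ⊛ g) (suc n) ≡ f (suc n) * g 0 + (f ⊛ tail g) n
⊛-suc f g zero    = solve 3 (λ u v o → u :+ (v :+ o) := v :+ (u :+ o)) refl (f 0 * g 1) (f 1 * g 0) 0ℚ
⊛-suc f g (suc n) = trans (cong (_+_ (f 0 * g (suc (suc n)))) (⊛-suc (tail f) g n))
  (solve 3 (λ u v w → u :+ (v :+ w) := v :+ (u :+ w)) refl
    (f 0 * g (suc (suc n))) (f (suc (suc n)) * g 0) ((tail f ⊛ tail g) n))

⊛-comm : ∀ f g → f ⊛ g ≗ g ⊛ f
⊛-comm f g zero    = cong (_+ 0ℚ) (ℚ.*-comm (f 0) (g 0))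
⊛-comm f g (suc n) = begin
  f 0 * g (suc n) + (tail f ⊛ g) n  ≡⟨ cong₂ _+_ (ℚ.*-comm (f 0) (g (suc n))) (⊛-comm (tail f) g n) ⟩
  g (suc n) * f 0 + (g ⊛ tail f) n  ≡⟨ ⊛-suc g f n ⟨
  (g ⊛ f) (suc n)                   ∎

⊛-assoc : ∀ f g h → (f ⊛ g) ⊛ h ≗ f ⊛ (g ⊛ h)
⊛-assoc f g h zero    = begin
  (f 0 * g 0 + 0ℚ) * h 0 + 0ℚ  ≡⟨ cong (λ x → x * h 0 + 0ℚ) (ℚ.+-identityʳ (f 0 * g 0)) ⟩
  f 0 * g 0 * h 0 + 0ℚ         ≡⟨ cong (_+ 0ℚ) (ℚ.*-assoc (f 0) (g 0) (h 0)) ⟩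
  f 0 * (g 0 * h 0) + 0ℚ       ≡⟨ cong (λ x → f 0 * x + 0ℚ) (ℚ.+-identityʳ (g 0 * h 0)) ⟨
  f 0 * (g 0 * h 0 + 0ℚ) + 0ℚ  ∎
⊛-assoc f g h (suc n) = begin
  (f 0 * g 0 + 0ℚ) * h (suc n) + (tail (f ⊛ g) ⊛ h) n
    -- `tail (f ⊛ g)` is definitionally `scale (f 0) (tail g) ⊕ tail f ⊛ g`.
    ≡⟨ cong₂ _+_ (cong (_* h (suc n)) (ℚ.+-identityʳ (f 0 * g 0))) (⊛-distribʳ h (scale (f 0) (tail g)) (tail f ⊛ g) n) ⟩
  f 0 * g 0 * h (suc n) + ((scale (f 0) (tail g) ⊛ h) n + ((tail f ⊛ g) ⊛ h) n)
    ≡⟨ cong (_+_ (f 0 * g 0 * h (suc n))) (cong₂ _+_ (scale-⊛ (f 0) (tail g) h n) (⊛-assoc (tail f) g h n)) ⟩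
  f 0 * g 0 * h (suc n) + (f 0 * (tail g ⊛ h) n + (tail f ⊛ (g ⊛ h)) n)
    ≡⟨ solve 5 (λ a b c u v → a :* b :* c :+ (a :* u :+ v) := a :* (b :* c :+ u) :+ v) refl
         (f 0) (g 0) (h (suc n)) ((tail g ⊛ h) n) ((tail f ⊛ (g ⊛ h)) n) ⟩
  f 0 * (g ⊛ h) (suc n) + (tail f ⊛ (g ⊛ h)) n ∎

⊛-zeroˡ : ∀ f → (λ _ → 0ℚ) ⊛ f ≗ λ _ → 0ℚ
⊛-zeroˡ f zero    = cong (_+ 0ℚ) (ℚ.*-zeroˡ (f 0))
⊛-zeroˡ f (suc n) = cong₂ _+_ (ℚ.*-zeroˡ (f (suc n))) (⊛-zeroˡ f n)

const-⊛ : ∀ c f → const c ⊛ f ≗ scale c f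
const-⊛ c f zero    = ℚ.+-identityʳ (c * f 0)
const-⊛ c f (suc n) = trans (cong (_+_ (c * f (suc n))) (⊛-zeroˡ f n)) (ℚ.+-identityʳ (c * f (suc n)))

⊛-identityˡ : ∀ f → const 1ℚ ⊛ f ≗ f
⊛-identityˡ f n = trans (const-⊛ 1ℚ f n) (ℚ.*-identityˡ (f n))

⊕-⊛-commutativeSemiring : CommutativeSemiring 0ℓ 0ℓ
⊕-⊛-commutativeSemiring = record
  { Carrier = Series
  ; _≈_ = _≗_
  ; _+_ = _⊕_
  ; _*_ = _⊛_
  ; 0# = λ _ → 0ℚ
  ; 1# = const 1ℚ
  ; isCommutativeSemiring = Biased.isCommutativeSemiringˡ record
    { +-isCommutativeMonoid = Biased.isCommutativeMonoidˡ record
      { isSemigroup = record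
        { isMagma = record
          { isEquivalence = Setoid.isEquivalence (ℕ →-setoid ℚ)
          ; ∙-cong = λ p q n → cong₂ _+_ (p n) (q n)
          }
        ; assoc = λ f g h n → ℚ.+-assoc (f n) (g n) (h n)
        }
      ; identityˡ = λ f n → ℚ.+-identityˡ (f n)
      ; comm = λ f g n → ℚ.+-comm (f n) (g n)
      }
    ; *-isCommutativeMonoid = Biased.isCommutativeMonoidˡ record
      { isSemigroup = record
        { isMagma = record
          { isEquivalence = Setoid.isEquivalence (ℕ →-setoid ℚ)
          ; ∙-cong = ⊛-cong
          }
        ; assoc = ⊛-assoc
        }
      ; identityˡ = ⊛-identityˡ
      ; comm = ⊛-comm
      }
    ; distribʳ = ⊛-distribʳ
    ; zeroˡ = ⊛-zeroˡ
    }
  }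

-- Differentiation and constant series

θ D : Series → Series
θ f n = fromℕ n * f n
D f = tail (θ f)

-- `θ` is t d/dt. It weights a coefficient by its degree, and the degree of a product of terms is
-- the sum of their degrees, so there is no index shift to handle.
θ-⊛ : ∀ f g → θ (f ⊛ g) ≗ θ f ⊛ g ⊕ f ⊛ θ g
θ-⊛ f g zero    = solve 2 (λ a b → con 0ℚ :* (a :* b :+ con 0ℚ)
    := con 0ℚ :* a :* b :+ con 0ℚ :+ (a :* (con 0ℚ :* b) :+ con 0ℚ)) refl (f 0) (g 0)
θ-⊛ f g (suc n) = begin
  N′ * (f 0 * g (suc n) + u)                         ≡⟨ solve 4 (λ N′ a b u → N′ :* (a :* b :+ u) := a :* (N′ :* b) :+ N′ :* u)
                                                          refl N′ (f 0) (g (suc n)) u ⟩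
  f 0 * (N′ * g (suc n)) + N′ * u                    ≡⟨ cong (_+_ (f 0 * (N′ * g (suc n)))) N′u ⟩
  f 0 * (N′ * g (suc n)) + ((D f ⊛ g) n + (tail f ⊛ θ g) n)
    ≡⟨ solve 5 (λ a b c u v → a :* b :+ (u :+ v) := con 0ℚ :* a :* c :+ u :+ (a :* b :+ v))
         refl (f 0) (N′ * g (suc n)) (g (suc n)) ((D f ⊛ g) n) ((tail f ⊛ θ g) n) ⟩
  (θ f ⊛ g ⊕ f ⊛ θ g) (suc n)                        ∎
  where
  N′ = fromℕ (suc n)
  u  = (tail f ⊛ g) n

  D-tail : D f ≗ tail f ⊕ θ (tail f)
  D-tail m = trans (cong (_* f (suc m)) (fromℕ-suc m))
    (trans (ℚ.*-distribʳ-+ (f (suc m)) 1ℚ (fromℕ m)) (cong (_+ θ (tail f) m) (ℚ.*-identityˡ (f (suc m)))))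

  N′u : N′ * u ≡ (D f ⊛ g) n + (tail f ⊛ θ g) n
  N′u = begin
    N′ * u                                                ≡⟨ cong (_* u) (fromℕ-suc n) ⟩
    (1ℚ + fromℕ n) * u                                    ≡⟨ ℚ.*-distribʳ-+ u 1ℚ (fromℕ n) ⟩
    1ℚ * u + θ (tail f ⊛ g) n                             ≡⟨ cong₂ _+_ (ℚ.*-identityˡ u) (θ-⊛ (tail f) g n) ⟩
    u + ((θ (tail f) ⊛ g) n + (tail f ⊛ θ g) n)           ≡⟨ ℚ.+-assoc u _ _ ⟨
    (tail f ⊛ g ⊕ θ (tail f) ⊛ g) n + (tail f ⊛ θ g) n    ≡⟨ cong (_+ (tail f ⊛ θ g) n) (⊛-distribʳ g (tail f) (θ (tail f)) n) ⟨
    ((tail f ⊕ θ (tail f)) ⊛ g) n + (tail f ⊛ θ g) n      ≡⟨ cong (_+ (tail f ⊛ θ g) n) (⊛-congˡ g D-tail n) ⟨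
    (D f ⊛ g) n + (tail f ⊛ θ g) n                        ∎

-- This is the rule for `θ` one degree higher: `θ f` and `θ g` have no constant term, so a factor t
-- can be divided out of each.
D-⊛ : ∀ f g → D (f ⊛ g) ≗ D f ⊛ g ⊕ f ⊛ D g
D-⊛ f g n = trans (θ-⊛ f g (suc n)) (cong₂ _+_
  (solve 3 (λ a b u → con 0ℚ :* a :* b :+ u := u) refl (f 0) (g (suc n)) ((D f ⊛ g) n))
  (⊛-tail f (θ g) (ℚ.*-zeroˡ (g 0)) n))

D-cong : ∀ {f g} → f ≗ g → D f ≗ D g
D-cong f≗g n = cong (fromℕ (suc n) *_) (f≗g (suc n))

D-⊕ : ∀ f g → D (f ⊕ g) ≗ D f ⊕ D g
D-⊕ f g n = ℚ.*-distribˡ-+ (fromℕ (suc n)) (f (suc n)) (g (suc n))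

D-const-⊛ : ∀ c f → D (const c ⊛ f) ≗ const c ⊛ D f
D-const-⊛ c f n = begin
  N * (const c ⊛ f) (suc n)  ≡⟨ cong (N *_) (const-⊛ c f (suc n)) ⟩
  N * (c * f (suc n))        ≡⟨ ℚ.*-assoc N c (f (suc n)) ⟨
  N * c * f (suc n)          ≡⟨ cong (_* f (suc n)) (ℚ.*-comm N c) ⟩
  c * N * f (suc n)          ≡⟨ ℚ.*-assoc c N (f (suc n)) ⟩
  c * D f n                  ≡⟨ const-⊛ c (D f) n ⟨
  (const c ⊛ D f) n          ∎
  where N = fromℕ (suc n)

D-X : D X ≗ const 1ℚ
D-X zero    = refl
D-X (suc n) = ℚ.*-zeroʳ (fromℕ (suc (suc n)))

D-exp : D exp ≗ exp
D-exp = exp-suc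

D-expm1 : D expm1 ≗ exp
D-expm1 n = trans (cong (fromℕ (suc n) *_) (ℚ.+-identityʳ (exp (suc n)))) (exp-suc n)

D-egf : ∀ a → D (egf a) ≗ egf (tail a)
D-egf a n = begin
  N * (a (suc n) ÷! suc n)       ≡⟨ cong (N *_) (÷!-exp (a (suc n)) (suc n)) ⟩
  N * (a (suc n) * exp (suc n))  ≡⟨ ℚ.*-assoc N (a (suc n)) (exp (suc n)) ⟨
  N * a (suc n) * exp (suc n)    ≡⟨ cong (_* exp (suc n)) (ℚ.*-comm N (a (suc n))) ⟩
  a (suc n) * N * exp (suc n)    ≡⟨ ℚ.*-assoc (a (suc n)) N (exp (suc n)) ⟩
  a (suc n) * (N * exp (suc n))  ≡⟨ cong (a (suc n) *_) (exp-suc n) ⟩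
  a (suc n) * exp n              ≡⟨ ÷!-exp (a (suc n)) n ⟨
  egf (tail a) n                 ∎
  where N = fromℕ (suc n)

exp-expm1 : exp ≗ const 1ℚ ⊕ expm1
exp-expm1 n = begin
  exp n                              ≡⟨ ℚ.+-identityʳ (exp n) ⟨
  exp n + 0ℚ                         ≡⟨ cong (exp n +_) (ℚ.+-inverseʳ (const 1ℚ n)) ⟨
  exp n + (const 1ℚ n - const 1ℚ n)  ≡⟨ solve 3 (λ a b c → a :+ (b :+ c) := b :+ (a :+ c)) refl (exp n) (const 1ℚ n) (- const 1ℚ n) ⟩
  const 1ℚ n + expm1 n               ∎

const-+ : ∀ c d → const (c + d) ≗ const c ⊕ const d
const-+ c d zero    = refl
const-+ c d (suc n) = refl

const-* : ∀ c d → const (c * d) ≗ const c ⊛ const d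
const-* c d zero    = sym (ℚ.+-identityʳ (c * d))
const-* c d (suc n) = sym (trans (const-⊛ c (const d) (suc n)) (ℚ.*-zeroʳ c))

nat : ℕ → Series
nat n = const (fromℕ n)

nat-suc : ∀ n → nat (suc n) ≗ const 1ℚ ⊕ nat n
nat-suc n m = trans (cong (λ c → const c m) (fromℕ-suc n)) (const-+ 1ℚ (fromℕ n) m)

nat-! : ∀ n → nat (suc n !) ≗ nat (suc n) ⊛ nat (n !)
nat-! n m = trans (cong (λ c → const c m) (fromℕ-* (suc n) (n !))) (const-* (fromℕ (suc n)) (fromℕ (n !)) m)

⊕-cancelʳ : ∀ h {f g} → f ⊕ h ≗ g ⊕ h → f ≗ g
⊕-cancelʳ h f⊕h≗g⊕h n = GroupProperties.∙-cancelʳ ℚ.+-0-group (h n) _ _ (f⊕h≗g⊕h n)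

-- Divided powers of eᵗ - 1

module S = CommutativeSemiring ⊕-⊛-commutativeSemiring
open SetoidReasoning S.setoid using (step-≈-⟩; step-≈-⟨) renaming (begin_ to begin-≗_; _∎ to _∎-≗)

⊛-scale : ∀ c f g → f ⊛ scale c g ≗ scale c (f ⊛ g)
⊛-scale c f g n = trans (⊛-comm f (scale c g) n) (trans (scale-⊛ c g f n) (cong (c *_) (⊛-comm g f n)))

⊛-distribˡ : ∀ h f g → h ⊛ (f ⊕ g) ≗ h ⊛ f ⊕ h ⊛ g
⊛-distribˡ = S.distribˡ

D-^ˢ : ∀ f k → D (f ^ˢ suc k) ≗ nat (suc k) ⊛ (f ^ˢ k ⊛ D f)
D-^ˢ f zero    = begin-≗
  D (f ⊛ const 1ℚ)          ≈⟨ D-cong (S.*-identityʳ f) ⟩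
  D f                       ≈⟨ S.*-identityˡ (D f) ⟨
  const 1ℚ ⊛ D f            ≈⟨ S.*-identityˡ (const 1ℚ ⊛ D f) ⟨
  nat 1 ⊛ (const 1ℚ ⊛ D f)  ∎-≗
D-^ˢ f (suc k) = begin-≗
  D (f ⊛ f ^ˢ suc k)                            ≈⟨ D-⊛ f (f ^ˢ suc k) ⟩
  D f ⊛ f ^ˢ suc k ⊕ f ⊛ D (f ^ˢ suc k)         ≈⟨ S.+-congˡ {D f ⊛ f ^ˢ suc k} (S.*-congˡ {f} (D-^ˢ f k)) ⟩
  D f ⊛ f ^ˢ suc k ⊕ f ⊛ (nat (suc k) ⊛ (f ^ˢ k ⊛ D f))
    ≈⟨ power-identity ⊕-⊛-commutativeSemiring f (D f) (f ^ˢ k) (nat (suc k)) ⟩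
  (const 1ℚ ⊕ nat (suc k)) ⊛ (f ^ˢ suc k ⊛ D f)  ≈⟨ S.*-congʳ {f ^ˢ suc k ⊛ D f} (nat-suc (suc k)) ⟨
  nat (suc (suc k)) ⊛ (f ^ˢ suc k ⊛ D f)         ∎-≗

-- The divided powers (eᵗ - 1)ᵏ / k!, whose coefficients are the Stirling numbers.
divPower : ℕ → Series
divPower k = scale (1ℚ ÷! k) (expm1 ^ˢ k)

-- The coefficient of z^q in (∑ₖ aₖ zᵏ) (∑ₖ fₖ zᵏ), where each fₖ is a series in t. At a fixed
-- degree `n` in t it is a Cauchy product in `k`, so the laws of `⊛` and `D` also serve for z.
conv : (ℕ → ℚ) → (ℕ → Series) → ℕ → Series
conv a f q n = (a ⊛ (λ k → f k n)) q

⊛-conv : ∀ g a f q → g ⊛ conv a f q ≗ conv a (λ k → g ⊛ f k) q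
⊛-conv g a f zero    n = begin
  (g ⊛ (λ m → a 0 * f 0 m + 0ℚ)) n  ≡⟨ S.*-congˡ {g} (λ m → ℚ.+-identityʳ (a 0 * f 0 m)) n ⟩
  (g ⊛ scale (a 0) (f 0)) n         ≡⟨ ⊛-scale (a 0) g (f 0) n ⟩
  a 0 * (g ⊛ f 0) n                 ≡⟨ ℚ.+-identityʳ (a 0 * (g ⊛ f 0) n) ⟨
  a 0 * (g ⊛ f 0) n + 0ℚ            ∎
⊛-conv g a f (suc q) n = begin
  (g ⊛ (scale (a 0) (f (suc q)) ⊕ conv (tail a) f q)) n
    ≡⟨ ⊛-distribˡ g (scale (a 0) (f (suc q))) (conv (tail a) f q) n ⟩
  (g ⊛ scale (a 0) (f (suc q))) n + (g ⊛ conv (tail a) f q) n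
    ≡⟨ cong₂ _+_ (⊛-scale (a 0) g (f (suc q)) n) (⊛-conv g (tail a) f q n) ⟩
  a 0 * (g ⊛ f (suc q)) n + conv (tail a) (λ k → g ⊛ f k) q n ∎

-- The coefficientwise form of d/dz e^(zx) = x e^(zx). The factorials match because `1ℚ ÷! k` is
-- literally `exp k`.
divPower-suc : ∀ k n → fromℕ (suc k) * divPower (suc k) n ≡ (expm1 ⊛ divPower k) n
divPower-suc k n = begin
  fromℕ (suc k) * ((1ℚ ÷! suc k) * (expm1 ^ˢ suc k) n)  ≡⟨ ℚ.*-assoc (fromℕ (suc k)) (1ℚ ÷! suc k) ((expm1 ^ˢ suc k) n) ⟨
  fromℕ (suc k) * (1ℚ ÷! suc k) * (expm1 ^ˢ suc k) n    ≡⟨ cong (_* (expm1 ^ˢ suc k) n) (exp-suc k) ⟩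
  (1ℚ ÷! k) * (expm1 ⊛ expm1 ^ˢ k) n                    ≡⟨ ⊛-scale (1ℚ ÷! k) expm1 (expm1 ^ˢ k) n ⟨
  (expm1 ⊛ divPower k) n                                ∎

-- Leibniz' rule for the series ∑ₖ aₖ zᵏ and exp (z (eᵗ - 1)), at z^q.
conv-suc : ∀ a q → nat (suc q) ⊛ conv a divPower (suc q) ≗ expm1 ⊛ conv a divPower q ⊕ conv (D a) divPower q
conv-suc a q n = begin
  (nat (suc q) ⊛ conv a divPower (suc q)) n                      ≡⟨ const-⊛ (fromℕ (suc q)) (conv a divPower (suc q)) n ⟩
  D (a ⊛ (λ k → divPower k n)) q                                 ≡⟨ D-⊛ a (λ k → divPower k n) q ⟩
  conv (D a) divPower q n + (a ⊛ D (λ k → divPower k n)) q       ≡⟨ cong (_+_ (conv (D a) divPower q n)) (S.*-congˡ {a} (λ k → divPower-suc k n) q) ⟩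
  conv (D a) divPower q n + conv a (λ k → expm1 ⊛ divPower k) q n ≡⟨ cong (_+_ (conv (D a) divPower q n)) (⊛-conv expm1 a divPower q n) ⟨
  conv (D a) divPower q n + (expm1 ⊛ conv a divPower q) n        ≡⟨ ℚ.+-comm (conv (D a) divPower q n) _ ⟩
  (expm1 ⊛ conv a divPower q ⊕ conv (D a) divPower q) n          ∎

conv-congˡ : ∀ {a b} f q → a ≗ b → conv a f q ≗ conv b f q
conv-congˡ f q a≗b n = ⊛-congˡ (λ k → f k n) a≗b q

conv-⊕ : ∀ a b f q → conv (a ⊕ b) f q ≗ conv a f q ⊕ conv b f q
conv-⊕ a b f q n = ⊛-distribʳ (λ k → f k n) a b q

exp-⊛ : ∀ f → exp ⊛ f ≗ expm1 ⊛ f ⊕ f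
exp-⊛ f = begin-≗
  exp ⊛ f                         ≈⟨ S.*-congʳ {f} exp-expm1 ⟩
  (const 1ℚ ⊕ expm1) ⊛ f          ≈⟨ ⊛-distribʳ f (const 1ℚ) expm1 ⟩
  const 1ℚ ⊛ f ⊕ expm1 ⊛ f        ≈⟨ S.+-congʳ {expm1 ⊛ f} (S.*-identityˡ f) ⟩
  f ⊕ expm1 ⊛ f                   ≈⟨ S.+-comm f (expm1 ⊛ f) ⟩
  expm1 ⊛ f ⊕ f                   ∎-≗

-- The binomial theorem for (1 + x)^q, read off from e^z e^(zx) = e^(z(1+x)) with 1 + x = eᵗ.
exp-power : ∀ q → nat (q !) ⊛ conv exp divPower q ≗ exp ^ˢ q
exp-power zero    = begin-≗
  const 1ℚ ⊛ conv exp divPower 0  ≈⟨ S.*-identityˡ (conv exp divPower 0) ⟩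
  conv exp divPower 0             ≈⟨ (λ n → trans (ℚ.+-identityʳ _) (trans (ℚ.*-identityˡ _) (ℚ.*-identityˡ (const 1ℚ n)))) ⟩
  const 1ℚ                        ∎-≗
exp-power (suc q) = begin-≗
  nat (suc q !) ⊛ conv exp divPower (suc q)                 ≈⟨ S.*-congʳ {conv exp divPower (suc q)} (nat-! q) ⟩
  nat (suc q) ⊛ nat (q !) ⊛ conv exp divPower (suc q)       ≈⟨ S.*-congʳ {conv exp divPower (suc q)} (⊛-comm (nat (suc q)) (nat (q !))) ⟩
  nat (q !) ⊛ nat (suc q) ⊛ conv exp divPower (suc q)       ≈⟨ ⊛-assoc (nat (q !)) (nat (suc q)) (conv exp divPower (suc q)) ⟩
  nat (q !) ⊛ (nat (suc q) ⊛ conv exp divPower (suc q))     ≈⟨ S.*-congˡ {nat (q !)} step ⟩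
  nat (q !) ⊛ (exp ⊛ conv exp divPower q)                   ≈⟨ ⊛-assoc (nat (q !)) exp (conv exp divPower q) ⟨
  nat (q !) ⊛ exp ⊛ conv exp divPower q                     ≈⟨ S.*-congʳ {conv exp divPower q} (⊛-comm (nat (q !)) exp) ⟩
  exp ⊛ nat (q !) ⊛ conv exp divPower q                     ≈⟨ ⊛-assoc exp (nat (q !)) (conv exp divPower q) ⟩
  exp ⊛ (nat (q !) ⊛ conv exp divPower q)                   ≈⟨ S.*-congˡ {exp} (exp-power q) ⟩
  exp ^ˢ suc q                                              ∎-≗
  where
  step : nat (suc q) ⊛ conv exp divPower (suc q) ≗ exp ⊛ conv exp divPower q
  step = begin-≗
    nat (suc q) ⊛ conv exp divPower (suc q)                  ≈⟨ conv-suc exp q ⟩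
    expm1 ⊛ conv exp divPower q ⊕ conv (D exp) divPower q    ≈⟨ S.+-congˡ {expm1 ⊛ conv exp divPower q} (conv-congˡ divPower q D-exp) ⟩
    expm1 ⊛ conv exp divPower q ⊕ conv exp divPower q        ≈⟨ exp-⊛ (conv exp divPower q) ⟨
    exp ⊛ conv exp divPower q                                ∎-≗

divPower-power : ∀ k → nat (k !) ⊛ divPower k ≗ expm1 ^ˢ k
divPower-power k n = begin
  (nat (k !) ⊛ divPower k) n                        ≡⟨ const-⊛ (fromℕ (k !)) (divPower k) n ⟩
  fromℕ (k !) * ((1ℚ ÷! k) * (expm1 ^ˢ k) n)        ≡⟨ ℚ.*-assoc (fromℕ (k !)) (1ℚ ÷! k) ((expm1 ^ˢ k) n) ⟨
  fromℕ (k !) * (1ℚ ÷! k) * (expm1 ^ˢ k) n          ≡⟨ cong (_* (expm1 ^ˢ k) n) (exp-inverse k) ⟩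
  1ℚ * (expm1 ^ˢ k) n                               ≡⟨ ℚ.*-identityˡ ((expm1 ^ˢ k) n) ⟩
  (expm1 ^ˢ k) n                                    ∎

-- The top power of x in (1 + x)^(q+1) comes from the constant term of `exp`, so `tail exp` accounts
-- for everything else. That remainder also appears in the recurrence of the harmonic convolution.
exp-power-remainder : ∀ q →
  nat (suc q) ⊛ nat (q !) ⊛ conv (tail exp) divPower q ⊕ expm1 ^ˢ suc q ≗ exp ^ˢ suc q
exp-power-remainder q = begin-≗
  nat (suc q) ⊛ nat (q !) ⊛ T ⊕ expm1 ^ˢ suc q               ≈⟨ S.+-cong (S.*-congʳ {T} (S.sym (nat-! q))) (S.sym (divPower-power (suc q))) ⟩
  nat (suc q !) ⊛ T ⊕ nat (suc q !) ⊛ divPower (suc q)       ≈⟨ S.+-comm (nat (suc q !) ⊛ T) _ ⟩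
  nat (suc q !) ⊛ divPower (suc q) ⊕ nat (suc q !) ⊛ T       ≈⟨ ⊛-distribˡ (nat (suc q !)) (divPower (suc q)) T ⟨
  nat (suc q !) ⊛ (divPower (suc q) ⊕ T)                     ≈⟨ S.*-congˡ {nat (suc q !)} (λ n → cong (_+ T n) (sym (ℚ.*-identityˡ (divPower (suc q) n)))) ⟩
  nat (suc q !) ⊛ conv exp divPower (suc q)                  ≈⟨ exp-power (suc q) ⟩
  exp ^ˢ suc q                                               ∎-≗
  where T = conv (tail exp) divPower q

-- The closed form of x^(p+1) b_p

∑-last : ∀ n (f : ℕ → ℚ) → ∑[ i < suc n ] f (toℕ i) ≡ (∑[ i < n ] f (toℕ i)) + f n
∑-last zero    f = ℚ.+-comm (f 0) 0ℚ
∑-last (suc n) f = trans (cong (f 0 +_) (∑-last n (f ∘ suc)))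
  (sym (ℚ.+-assoc (f 0) (∑[ i < n ] f (suc (toℕ i))) (f (suc n))))

harmonic-suc : ∀ n → harmonic (suc n) ≡ harmonic n + (ℤ.+ 1 / suc n)
harmonic-suc n = ∑-last n (λ i → ℤ.+ 1 / suc i)

-- The increment 1/(n+1) of the harmonic numbers, divided by n!, is 1/(n+1)!. In the variable z this
-- reads h′ = h + (e^z - 1)/z.
D-egf-harmonic : D (egf harmonic) ≗ egf harmonic ⊕ tail exp
D-egf-harmonic n = begin
  D (egf harmonic) n                       ≡⟨ D-egf harmonic n ⟩
  harmonic (suc n) ÷! n                    ≡⟨ ÷!-exp (harmonic (suc n)) n ⟩
  harmonic (suc n) * exp n                 ≡⟨ cong (_* exp n) (harmonic-suc n) ⟩
  (harmonic n + r) * exp n                 ≡⟨ ℚ.*-distribʳ-+ (exp n) (harmonic n) r ⟩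
  harmonic n * exp n + r * exp n           ≡⟨ cong₂ _+_ (sym (÷!-exp (harmonic n) n)) r*exp ⟩
  (egf harmonic ⊕ tail exp) n              ∎
  where
  r = ℤ.+ 1 / suc n

  r*exp : r * exp n ≡ exp (suc n)
  r*exp = begin
    r * exp n                          ≡⟨ cong (r *_) (exp-suc n) ⟨
    r * (fromℕ (suc n) * exp (suc n))  ≡⟨ ℚ.*-assoc r (fromℕ (suc n)) (exp (suc n)) ⟨
    r * fromℕ (suc n) * exp (suc n)    ≡⟨ cong (_* exp (suc n)) (trans (ℚ.*-comm r (fromℕ (suc n))) (fromℕ-inverse (suc n))) ⟩
    1ℚ * exp (suc n)                   ≡⟨ ℚ.*-identityˡ (exp (suc n)) ⟩
    exp (suc n)                        ∎

harmonicConv : ℕ → Series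
harmonicConv = conv (egf harmonic) divPower

X-H : ℕ → Series
X-H p = X ⊖ const (harmonic p)

closedForm : ℕ → Series
closedForm p = nat (p !) ⊛ (X-H p ⊛ exp ^ˢ p) ⊕ nat (p !) ⊛ nat (p !) ⊛ harmonicConv p

X-H-suc : ∀ p → X-H p ≗ X-H (suc p) ⊕ const (ℤ.+ 1 / suc p)
X-H-suc p zero    = trans (lemma 0ℚ (harmonic p) (ℤ.+ 1 / suc p)) (cong (λ h → 0ℚ - h + (ℤ.+ 1 / suc p)) (sym (harmonic-suc p)))
  where
  lemma : ∀ a h r → a - h ≡ a - (h + r) + r
  lemma = solve 3 (λ a h r → a :- h := a :- (h :+ r) :+ r) refl
X-H-suc p (suc n) = sym (ℚ.+-identityʳ (X (suc n) - 0ℚ))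

harmonicConv-suc : ∀ p → nat (suc p) ⊛ harmonicConv (suc p) ≗ exp ⊛ harmonicConv p ⊕ conv (tail exp) divPower p
harmonicConv-suc p = begin-≗
  nat (suc p) ⊛ harmonicConv (suc p)                                      ≈⟨ conv-suc (egf harmonic) p ⟩
  expm1 ⊛ harmonicConv p ⊕ conv (D (egf harmonic)) divPower p             ≈⟨ S.+-congˡ {expm1 ⊛ harmonicConv p} (conv-congˡ divPower p D-egf-harmonic) ⟩
  expm1 ⊛ harmonicConv p ⊕ conv (egf harmonic ⊕ tail exp) divPower p      ≈⟨ S.+-congˡ {expm1 ⊛ harmonicConv p} (conv-⊕ (egf harmonic) (tail exp) divPower p) ⟩
  expm1 ⊛ harmonicConv p ⊕ (harmonicConv p ⊕ conv (tail exp) divPower p)  ≈⟨ S.+-assoc (expm1 ⊛ harmonicConv p) (harmonicConv p) (conv (tail exp) divPower p) ⟨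
  expm1 ⊛ harmonicConv p ⊕ harmonicConv p ⊕ conv (tail exp) divPower p    ≈⟨ S.+-congʳ {conv (tail exp) divPower p} (exp-⊛ (harmonicConv p)) ⟨
  exp ⊛ harmonicConv p ⊕ conv (tail exp) divPower p                       ∎-≗

nat-inverse : ∀ n → nat (suc n) ⊛ const (ℤ.+ 1 / suc n) ≗ const 1ℚ
nat-inverse n m = trans (sym (const-* (fromℕ (suc n)) (ℤ.+ 1 / suc n) m)) (cong (λ c → const c m) (fromℕ-inverse (suc n)))

closedForm-zero : closedForm 0 ≗ X
closedForm-zero = begin-≗
  const 1ℚ ⊛ (X-H 0 ⊛ const 1ℚ) ⊕ const 1ℚ ⊛ const 1ℚ ⊛ harmonicConv 0
    ≈⟨ S.+-cong (S.trans (S.*-identityˡ (X-H 0 ⊛ const 1ℚ)) (S.trans (S.*-identityʳ (X-H 0)) X-H≗)) harmonicConv≗ ⟩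
  X ⊕ (λ _ → 0ℚ)   ≈⟨ S.+-identityʳ X ⟩
  X                ∎-≗
  where
  X-H≗ : X-H 0 ≗ X
  X-H≗ zero    = refl
  X-H≗ (suc n) = ℚ.+-identityʳ (X (suc n))

  harmonicConv≗ : const 1ℚ ⊛ const 1ℚ ⊛ harmonicConv 0 ≗ λ _ → 0ℚ
  harmonicConv≗ = S.trans (S.*-congˡ {const 1ℚ ⊛ const 1ℚ} (λ n → trans (ℚ.+-identityʳ (0ℚ * divPower 0 n)) (ℚ.*-zeroˡ (divPower 0 n))))
    (S.zeroʳ (const 1ℚ ⊛ const 1ℚ))

closedForm-suc : ∀ p →
  closedForm (suc p) ⊕ nat (p !) ⊛ expm1 ^ˢ suc p ≗ nat (suc p) ⊛ (exp ⊛ closedForm p)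
closedForm-suc p = begin-≗
  nat (suc p !) ⊛ (X-H (suc p) ⊛ exp ^ˢ suc p) ⊕ nat (suc p !) ⊛ nat (suc p !) ⊛ harmonicConv (suc p) ⊕ nat (p !) ⊛ expm1 ^ˢ suc p
    ≈⟨ S.+-congʳ {nat (p !) ⊛ expm1 ^ˢ suc p} (S.+-cong
         (S.*-congʳ {X-H (suc p) ⊛ exp ^ˢ suc p} (nat-! p))
         (S.*-congʳ {harmonicConv (suc p)} (S.*-cong (nat-! p) (nat-! p)))) ⟩
  P ⊛ F ⊛ (X-H (suc p) ⊛ exp ^ˢ suc p) ⊕ P ⊛ F ⊛ (P ⊛ F) ⊛ harmonicConv (suc p) ⊕ F ⊛ expm1 ^ˢ suc p
    ≈⟨ closedForm-identity ⊕-⊛-commutativeSemiring {P} {F} {exp ^ˢ p} {X-H p} {X-H (suc p)} {const (ℤ.+ 1 / suc p)} {exp} {expm1 ^ˢ suc p} {harmonicConv p} {harmonicConv (suc p)}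
         (harmonicConv-suc p) (exp-power-remainder p) (X-H-suc p) (nat-inverse p) ⟩
  P ⊛ (exp ⊛ closedForm p) ∎-≗
  where
  P = nat (suc p)
  F = nat (p !)

D-expm1-^ˢ : ∀ p → D (expm1 ^ˢ suc p) ≗ nat (suc p) ⊛ (expm1 ^ˢ p ⊛ exp)
D-expm1-^ˢ p = S.trans (D-^ˢ expm1 p) (S.*-congˡ {nat (suc p)} (S.*-congˡ {expm1 ^ˢ p} D-expm1))

-- Induction through the recursion `closedForm-suc` avoids differentiating the harmonic sum itself.
D-closedForm : ∀ p → D (closedForm p) ≗ nat p ⊛ closedForm p ⊕ nat (p !) ⊛ expm1 ^ˢ p
D-closedForm zero    = begin-≗
  D (closedForm 0)                                ≈⟨ D-cong closedForm-zero ⟩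
  D X                                             ≈⟨ D-X ⟩
  const 1ℚ                                        ≈⟨ S.*-identityˡ (const 1ℚ) ⟨
  const 1ℚ ⊛ const 1ℚ                             ≈⟨ S.+-identityˡ (const 1ℚ ⊛ const 1ℚ) ⟨
  (λ _ → 0ℚ) ⊕ const 1ℚ ⊛ const 1ℚ                ≈⟨ S.+-congʳ {const 1ℚ ⊛ const 1ℚ} (λ n → trans (const-⊛ 0ℚ (closedForm 0) n) (ℚ.*-zeroˡ (closedForm 0 n))) ⟨
  nat 0 ⊛ closedForm 0 ⊕ const 1ℚ ⊛ const 1ℚ      ∎-≗
D-closedForm (suc p) = S.trans
  (⊕-cancelʳ (F ⊛ (P ⊛ (expm1 ^ˢ p ⊛ exp)))
    (derivative-identity ⊕-⊛-commutativeSemiring {P} {F} {exp} {expm1 ^ˢ suc p} {expm1 ^ˢ p} {nat p} {closedForm p} {closedForm (suc p)} {D (closedForm p)} {D (closedForm (suc p))}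
      (nat-suc p) (closedForm-suc p) (D-closedForm p) derived))
  (S.+-congˡ {P ⊛ closedForm (suc p)} (S.*-congʳ {expm1 ^ˢ suc p} (S.sym (nat-! p))))
  where
  P = nat (suc p)
  F = nat (p !)

  derived : D (closedForm (suc p)) ⊕ F ⊛ (P ⊛ (expm1 ^ˢ p ⊛ exp)) ≗ P ⊛ (exp ⊛ closedForm p ⊕ exp ⊛ D (closedForm p))
  derived = begin-≗
    D (closedForm (suc p)) ⊕ F ⊛ (P ⊛ (expm1 ^ˢ p ⊛ exp))
      ≈⟨ S.+-congˡ {D (closedForm (suc p))} (S.trans (D-const-⊛ (fromℕ (p !)) (expm1 ^ˢ suc p)) (S.*-congˡ {F} (D-expm1-^ˢ p))) ⟨
    D (closedForm (suc p)) ⊕ D (F ⊛ expm1 ^ˢ suc p)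
      ≈⟨ D-⊕ (closedForm (suc p)) (F ⊛ expm1 ^ˢ suc p) ⟨
    D (closedForm (suc p) ⊕ F ⊛ expm1 ^ˢ suc p)
      ≈⟨ D-cong (closedForm-suc p) ⟩
    D (P ⊛ (exp ⊛ closedForm p))
      ≈⟨ D-const-⊛ (fromℕ (suc p)) (exp ⊛ closedForm p) ⟩
    P ⊛ D (exp ⊛ closedForm p)
      ≈⟨ S.*-congˡ {P} (S.trans (D-⊛ exp (closedForm p)) (S.+-congʳ {exp ⊛ D (closedForm p)} (S.*-congʳ {closedForm p} D-exp))) ⟩
    P ⊛ (exp ⊛ closedForm p ⊕ exp ⊛ D (closedForm p)) ∎-≗

-- For an abstract `b`, the Bernoulli numbers will enter only through the base case and the Stirling
-- numbers of the first kind only through the step.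
product-closedForm : (b : ℕ → Series) → expm1 ⊛ b 0 ≗ X → (∀ p → b (suc p) ⊕ D (b p) ≗ nat p ⊛ b p) →
  ∀ p → expm1 ^ˢ suc p ⊛ b p ≗ closedForm p
product-closedForm b base step zero    = begin-≗
  (expm1 ⊛ const 1ℚ) ⊛ b 0  ≈⟨ S.*-congʳ {b 0} (S.*-identityʳ expm1) ⟩
  expm1 ⊛ b 0               ≈⟨ base ⟩
  X                         ≈⟨ closedForm-zero ⟨
  closedForm 0              ∎-≗
product-closedForm b base step (suc p) = ⊕-cancelʳ (expm1 ^ˢ suc (suc p) ⊛ D (b p) ⊕ nat (p !) ⊛ expm1 ^ˢ suc p)
  (product-identity ⊕-⊛-commutativeSemiring {nat (suc p)} {nat (p !)} {exp} {expm1} {expm1 ^ˢ p} {nat p} {closedForm p} {closedForm (suc p)} {D (closedForm p)} {b p} {b (suc p)} {D (b p)}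
    (closedForm-suc p) (D-closedForm p) (step p) IH
    (begin-≗
      nat (suc p) ⊛ (expm1 ^ˢ p ⊛ exp) ⊛ b p ⊕ expm1 ^ˢ suc p ⊛ D (b p)
        ≈⟨ S.+-congʳ {expm1 ^ˢ suc p ⊛ D (b p)} (S.*-congʳ {b p} (D-expm1-^ˢ p)) ⟨
      D (expm1 ^ˢ suc p) ⊛ b p ⊕ expm1 ^ˢ suc p ⊛ D (b p)
        ≈⟨ D-⊛ (expm1 ^ˢ suc p) (b p) ⟨
      D (expm1 ^ˢ suc p ⊛ b p)
        ≈⟨ D-cong IH ⟩
      D (closedForm p) ∎-≗))
  where
  IH : expm1 ^ˢ suc p ⊛ b p ≗ closedForm p
  IH = product-closedForm b base step p

-- Coefficients

D-exp-^ˢ : ∀ p → D (exp ^ˢ p) ≗ nat p ⊛ exp ^ˢ p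
D-exp-^ˢ zero    n = trans (ℚ.*-zeroʳ (fromℕ (suc n))) (sym (trans (const-⊛ 0ℚ (const 1ℚ) n) (ℚ.*-zeroˡ (const 1ℚ n))))
D-exp-^ˢ (suc p) = S.trans (D-^ˢ exp p)
  (S.*-congˡ {nat (suc p)} (S.trans (S.*-congˡ {exp ^ˢ p} D-exp) (⊛-comm (exp ^ˢ p) exp)))

coeff!-D : ∀ f n → coeff! (D f) n ≡ coeff! f (suc n)
coeff!-D f n = begin
  fromℕ (n !) * (fromℕ (suc n) * f (suc n))  ≡⟨ ℚ.*-assoc (fromℕ (n !)) (fromℕ (suc n)) (f (suc n)) ⟨
  fromℕ (n !) * fromℕ (suc n) * f (suc n)    ≡⟨ cong (_* f (suc n)) (trans (ℚ.*-comm (fromℕ (n !)) (fromℕ (suc n))) (sym (fromℕ-* (suc n) (n !)))) ⟩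
  coeff! f (suc n)                           ∎

-- The equation D E = p E multiplies each coefficient by `p`. The constant term is 1 for every `p`,
-- in agreement with 0⁰ = 1.
coeff!-exp-^ˢ : ∀ p n → coeff! (exp ^ˢ p) n ≡ fromℕ (p ^ℕ n)
coeff!-exp-^ˢ p zero    = trans (ℚ.*-identityˡ ((exp ^ˢ p) 0)) (constant p)
  where
  constant : ∀ p → (exp ^ˢ p) 0 ≡ 1ℚ
  constant zero    = refl
  constant (suc p) = trans (ℚ.+-identityʳ (1ℚ * (exp ^ˢ p) 0)) (trans (ℚ.*-identityˡ ((exp ^ˢ p) 0)) (constant p))
coeff!-exp-^ˢ p (suc n) = begin
  coeff! E (suc n)                        ≡⟨ coeff!-D E n ⟨
  fromℕ (n !) * D E n                     ≡⟨ cong (fromℕ (n !) *_) (trans (D-exp-^ˢ p n) (const-⊛ (fromℕ p) E n)) ⟩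
  fromℕ (n !) * (fromℕ p * E n)           ≡⟨ solve 3 (λ a b c → a :* (b :* c) := b :* (a :* c)) refl (fromℕ (n !)) (fromℕ p) (E n) ⟩
  fromℕ p * coeff! E n                    ≡⟨ cong (fromℕ p *_) (coeff!-exp-^ˢ p n) ⟩
  fromℕ p * fromℕ (p ^ℕ n)               ≡⟨ fromℕ-* p (p ^ℕ n) ⟨
  fromℕ (p ^ℕ suc n)                     ∎
  where
  E = exp ^ˢ p

-- Ranges of summation, vanishing coefficients and binomial convolution

sum-zero : ∀ n {f : Fin n → ℚ} → (∀ i → f i ≡ 0ℚ) → ∑[ i < n ] f i ≡ 0ℚ
sum-zero n f≡0 = trans (sum-cong-≗ f≡0) (sum-replicate-zero n)

sum-drop : ∀ a m (f : ℕ → ℚ) → (∀ k → k < a → f k ≡ 0ℚ) → ∑[ i < a +ℕ m ] f (toℕ i) ≡ ∑[ i < m ] f (a +ℕ toℕ i)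
sum-drop zero    m f f≡0 = refl
sum-drop (suc a) m f f≡0 = trans
  (cong₂ _+_ (f≡0 0 ℕ.z<s) (sum-drop a m (f ∘ suc) (λ k k<a → f≡0 (suc k) (ℕ.s<s k<a))))
  (ℚ.+-identityˡ _)

∑-range-cong : ∀ a b {f g : ℕ → ℚ} → a ≤ suc b → (∀ k → k ≤ b → f k ≡ g k) → ∑-range a b f ≡ ∑-range a b g
∑-range-cong a b a≤1+b f≡g = sum-cong-≗ λ i → f≡g (a +ℕ toℕ i)
  (ℕ.≤-pred (subst (a +ℕ toℕ i <_) (ℕ.m+[n∸m]≡n a≤1+b) (ℕ.+-monoʳ-< a (Fin.toℕ<n i))))

∑-range-drop : ∀ a b (f : ℕ → ℚ) → a ≤ suc b → (∀ k → k < a → f k ≡ 0ℚ) → ∑-range a b f ≡ ∑[ i ≤ b ] f (toℕ i)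
∑-range-drop a b f a≤1+b f≡0 = trans (sym (sum-drop a (suc b ∸ a) f f≡0))
  (cong (λ n → ∑[ i < n ] f (toℕ i)) (ℕ.m+[n∸m]≡n a≤1+b))

⊛-vanish : ∀ f g n → (∀ k → k ≤ n → g k ≡ 0ℚ) → (f ⊛ g) n ≡ 0ℚ
⊛-vanish f g n g≡0 = sum-zero (suc n) λ i → trans
  (cong (f (toℕ i) *_) (g≡0 (n ∸ toℕ i) (ℕ.m∸n≤m n (toℕ i)))) (ℚ.*-zeroʳ (f (toℕ i)))

-- Since `expm1` has no constant term, each further factor raises the order of the power.
expm1-^ˢ-vanish : ∀ q k → k < q → (expm1 ^ˢ q) k ≡ 0ℚ
expm1-^ˢ-vanish (suc q) zero    _ = trans (ℚ.+-identityʳ (0ℚ * (expm1 ^ˢ q) 0)) (ℚ.*-zeroˡ ((expm1 ^ˢ q) 0))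
expm1-^ˢ-vanish (suc q) (suc k) (ℕ.s≤s k<q) = cong₂ _+_ (ℚ.*-zeroˡ ((expm1 ^ˢ q) (suc k)))
  (⊛-vanish (tail expm1) (expm1 ^ˢ q) k (λ l l≤k → expm1-^ˢ-vanish q l (ℕ.≤-<-trans l≤k k<q)))

stirling₂-vanish : ∀ k q → k < q → stirling₂ k q ≡ 0ℚ
stirling₂-vanish k q k<q = begin
  fromℕ (k !) * ((1ℚ ÷! q) * (expm1 ^ˢ q) k)  ≡⟨ cong (λ c → fromℕ (k !) * ((1ℚ ÷! q) * c)) (expm1-^ˢ-vanish q k k<q) ⟩
  fromℕ (k !) * ((1ℚ ÷! q) * 0ℚ)              ≡⟨ cong (fromℕ (k !) *_) (ℚ.*-zeroʳ (1ℚ ÷! q)) ⟩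
  fromℕ (k !) * 0ℚ                            ≡⟨ ℚ.*-zeroʳ (fromℕ (k !)) ⟩
  0ℚ                                          ∎

nCk*k!*[n∸k]!≡n! : ∀ {n k} → k ≤ n → (n C k) *ℕ (k ! *ℕ (n ∸ k) !) ≡ n !
nCk*k!*[n∸k]!≡n! {n} {k} k≤n = trans (cong (ℕ._* (k ! *ℕ (n ∸ k) !)) (nCk≡n!/k![n-k]! k≤n))
  (ℕ.m/n*n≡m (subst (ℕ._∣ n !) (ℕ.*-comm ((n ∸ k) !) (k !)) ([n∸k]!k!∣n! k≤n)))
  where instance _ = k ℕ.!* (n ∸ k) !≢0

fromℕ-C : ∀ {n k} → k ≤ n → fromℕ (n C k) ≡ fromℕ (n !) * (exp k * exp (n ∸ k))
fromℕ-C {n} {k} k≤n = begin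
  c                                      ≡⟨ solve 1 (λ c → c := c :* (con 1ℚ :* con 1ℚ)) refl c ⟩
  c * (1ℚ * 1ℚ)                          ≡⟨ cong (c *_) (cong₂ _*_ (exp-inverse k) (exp-inverse (n ∸ k))) ⟨
  c * (fromℕ (k !) * exp k * (fromℕ ((n ∸ k) !) * exp (n ∸ k)))
    ≡⟨ solve 5 (λ c a x b y → c :* (a :* x :* (b :* y)) := c :* (a :* b) :* (x :* y)) refl
         c (fromℕ (k !)) (exp k) (fromℕ ((n ∸ k) !)) (exp (n ∸ k)) ⟩
  c * (fromℕ (k !) * fromℕ ((n ∸ k) !)) * (exp k * exp (n ∸ k))
    ≡⟨ cong (_* (exp k * exp (n ∸ k))) (begin
         c * (fromℕ (k !) * fromℕ ((n ∸ k) !))          ≡⟨ cong (c *_) (fromℕ-* (k !) ((n ∸ k) !)) ⟨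
         c * fromℕ (k ! *ℕ (n ∸ k) !)                  ≡⟨ fromℕ-* (n C k) (k ! *ℕ (n ∸ k) !) ⟨
         fromℕ ((n C k) *ℕ (k ! *ℕ (n ∸ k) !))        ≡⟨ cong fromℕ (nCk*k!*[n∸k]!≡n! k≤n) ⟩
         fromℕ (n !)                                    ∎) ⟩
  fromℕ (n !) * (exp k * exp (n ∸ k))    ∎
  where
  c = fromℕ (n C k)

binomial-convolution : ∀ a b n →
  ∑[ i ≤ n ] (fromℕ (n C toℕ i) * a (toℕ i) * b (n ∸ toℕ i)) ≡ coeff! (egf a ⊛ egf b) n
binomial-convolution a b n = begin
  ∑[ i ≤ n ] (fromℕ (n C toℕ i) * a (toℕ i) * b (n ∸ toℕ i))
    ≡⟨ sum-cong-≗ {suc n} (λ i → term (toℕ i) (ℕ.≤-pred (Fin.toℕ<n i))) ⟩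
  ∑[ i ≤ n ] (fromℕ (n !) * (egf a (toℕ i) * egf b (n ∸ toℕ i)))
    ≡⟨ *-distribˡ-sum (fromℕ (n !)) (λ (i : Fin (suc n)) → egf a (toℕ i) * egf b (n ∸ toℕ i)) ⟨
  coeff! (egf a ⊛ egf b) n ∎
  where
  term : ∀ k → k ≤ n → fromℕ (n C k) * a k * b (n ∸ k) ≡ fromℕ (n !) * (egf a k * egf b (n ∸ k))
  term k k≤n = begin
    fromℕ (n C k) * a k * b (n ∸ k)
      ≡⟨ cong (λ c → c * a k * b (n ∸ k)) (fromℕ-C k≤n) ⟩
    fromℕ (n !) * (exp k * exp (n ∸ k)) * a k * b (n ∸ k)
      ≡⟨ solve 5 (λ f x y u v → f :* (x :* y) :* u :* v := f :* (u :* x :* (v :* y))) refl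
           (fromℕ (n !)) (exp k) (exp (n ∸ k)) (a k) (b (n ∸ k)) ⟩
    fromℕ (n !) * (a k * exp k * (b (n ∸ k) * exp (n ∸ k)))
      ≡⟨ cong (fromℕ (n !) *_) (cong₂ _*_ (÷!-exp (a k) k) (÷!-exp (b (n ∸ k)) (n ∸ k))) ⟨
    fromℕ (n !) * (egf a k * egf b (n ∸ k)) ∎

-- Alternating sums of Bernoulli numbers

∑-stirling₁ : ℕ → (ℕ → ℚ) → ℚ
∑-stirling₁ p g = ∑[ j ≤ p ] (fromℕ (stirling₁ p (toℕ j)) * g (toℕ j))

-- For `g j` = zʲ the sum is the rising factorial z (z+1) ⋯ (z+p-1), and this is multiplication by p
-- + z. For a general `g`, multiplication by z becomes the shift `g ∘ suc`.
∑-stirling₁-suc : ∀ p g → ∑-stirling₁ (suc p) g ≡ fromℕ p * ∑-stirling₁ p g + ∑-stirling₁ p (g ∘ suc)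
∑-stirling₁-suc p g = begin
  s (suc p) 0 * g 0 + ∑[ i ≤ p ] (s (suc p) (suc (toℕ i)) * g (suc (toℕ i)))
    ≡⟨ cong₂ _+_ (cong (_* g 0) (trans (cong fromℕ (stirling₁-zero p)) (fromℕ-* p (stirling₁ p 0))))
         (sum-cong-≗ {suc p} (λ i → term (toℕ i))) ⟩
  N * s p 0 * g 0 + ∑[ i ≤ p ] (s p (toℕ i) * g (suc (toℕ i)) + N * (s p (suc (toℕ i)) * g (suc (toℕ i))))
    ≡⟨ cong (_+_ (N * s p 0 * g 0)) (trans (∑-distrib-+ {suc p} (λ i → s p (toℕ i) * g (suc (toℕ i))) (λ i → N * (s p (suc (toℕ i)) * g (suc (toℕ i)))))
         (cong (_+_ (∑-stirling₁ p (g ∘ suc))) (sym (*-distribˡ-sum {suc p} N (λ i → s p (suc (toℕ i)) * g (suc (toℕ i))))))) ⟩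
  N * s p 0 * g 0 + (∑-stirling₁ p (g ∘ suc) + N * ∑[ i ≤ p ] (s p (suc (toℕ i)) * g (suc (toℕ i))))
    -- The index p+1 exceeds the number of points, so dropping its term leaves the sum for `p`
    -- without its term at 0.
    ≡⟨ cong (λ x → N * s p 0 * g 0 + (∑-stirling₁ p (g ∘ suc) + N * x)) last ⟩
  N * s p 0 * g 0 + (∑-stirling₁ p (g ∘ suc) + N * rest)
    ≡⟨ solve 5 (λ N a b u r → N :* a :* b :+ (u :+ N :* r) := N :* (a :* b :+ r) :+ u) refl N (s p 0) (g 0) (∑-stirling₁ p (g ∘ suc)) rest ⟩
  N * ∑-stirling₁ p g + ∑-stirling₁ p (g ∘ suc) ∎
  where
  N = fromℕ p

  s : ℕ → ℕ → ℚ
  s n k = fromℕ (stirling₁ n k)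

  rest : ℚ
  rest = ∑[ i < p ] (s p (suc (toℕ i)) * g (suc (toℕ i)))

  term : ∀ j → s (suc p) (suc j) * g (suc j) ≡ s p j * g (suc j) + N * (s p (suc j) * g (suc j))
  term j = begin
    s (suc p) (suc j) * g (suc j)
      ≡⟨ cong (_* g (suc j)) (trans (cong fromℕ (stirling₁-suc p j))
           (trans (fromℕ-+ (stirling₁ p j) (p *ℕ stirling₁ p (suc j))) (cong (_+_ (s p j)) (fromℕ-* p (stirling₁ p (suc j)))))) ⟩
    (s p j + N * s p (suc j)) * g (suc j)
      ≡⟨ solve 4 (λ a N b g → (a :+ N :* b) :* g := a :* g :+ N :* (b :* g)) refl (s p j) N (s p (suc j)) (g (suc j)) ⟩
    s p j * g (suc j) + N * (s p (suc j) * g (suc j)) ∎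

  last : ∑[ i ≤ p ] (s p (suc (toℕ i)) * g (suc (toℕ i))) ≡ rest
  last = begin
    ∑[ i ≤ p ] (s p (suc (toℕ i)) * g (suc (toℕ i)))   ≡⟨ ∑-last p (λ j → s p (suc j) * g (suc j)) ⟩
    rest + s p (suc p) * g (suc p)                     ≡⟨ cong (λ x → rest + fromℕ x * g (suc p)) (stirling₁-> p (suc p) (ℕ.n<1+n p)) ⟩
    rest + 0ℚ * g (suc p)                              ≡⟨ cong (_+_ rest) (ℚ.*-zeroˡ (g (suc p))) ⟩
    rest + 0ℚ                                          ≡⟨ ℚ.+-identityʳ rest ⟩
    rest                                               ∎

β : ℕ → ℕ → ℚ
β p m = ∑-stirling₁ p (λ j → (- 1ℚ) ^ j * bernoulli (m +ℕ j))

β-zero : ∀ m → β 0 m ≡ bernoulli m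
β-zero m = begin
  1ℚ * (1ℚ * bernoulli (m +ℕ 0)) + 0ℚ  ≡⟨ ℚ.+-identityʳ _ ⟩
  1ℚ * (1ℚ * bernoulli (m +ℕ 0))       ≡⟨ ℚ.*-identityˡ _ ⟩
  1ℚ * bernoulli (m +ℕ 0)              ≡⟨ ℚ.*-identityˡ _ ⟩
  bernoulli (m +ℕ 0)                   ≡⟨ cong bernoulli (ℕ.+-identityʳ m) ⟩
  bernoulli m                           ∎

-- Shifting the weight flips its sign and raises the Bernoulli index by one, so the shifted sum is
-- the negative of `β p (suc m)`. For the generating series this is b_(p+1) = (p - D) b_p.
β-suc : ∀ p m → β (suc p) m + β p (suc m) ≡ fromℕ p * β p m
β-suc p m = begin
  β (suc p) m + β p (suc m)
    ≡⟨ cong (_+ β p (suc m)) (∑-stirling₁-suc p g) ⟩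
  fromℕ p * β p m + ∑-stirling₁ p (g ∘ suc) + β p (suc m)
    ≡⟨ ℚ.+-assoc (fromℕ p * β p m) _ _ ⟩
  fromℕ p * β p m + (∑-stirling₁ p (g ∘ suc) + β p (suc m))
    ≡⟨ cong (_+_ (fromℕ p * β p m)) (trans (sym (∑-distrib-+ {suc p} (λ i → fromℕ (stirling₁ p (toℕ i)) * g (suc (toℕ i)))
         (λ i → fromℕ (stirling₁ p (toℕ i)) * ((- 1ℚ) ^ toℕ i * bernoulli (suc m +ℕ toℕ i))))) (sum-zero (suc p) (λ i → term (toℕ i)))) ⟩
  fromℕ p * β p m + 0ℚ
    ≡⟨ ℚ.+-identityʳ (fromℕ p * β p m) ⟩
  fromℕ p * β p m ∎
  where
  g : ℕ → ℚ
  g j = (- 1ℚ) ^ j * bernoulli (m +ℕ j)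

  term : ∀ j → fromℕ (stirling₁ p j) * g (suc j) + fromℕ (stirling₁ p j) * ((- 1ℚ) ^ j * bernoulli (suc m +ℕ j)) ≡ 0ℚ
  term j = trans
    (cong (λ i → fromℕ (stirling₁ p j) * ((- 1ℚ) ^ suc j * bernoulli i) + fromℕ (stirling₁ p j) * ((- 1ℚ) ^ j * bernoulli (suc m +ℕ j))) (ℕ.+-suc m j))
    (solve 3 (λ s e b → s :* (con (- 1ℚ) :* e :* b) :+ s :* (e :* b) := con 0ℚ) refl
      (fromℕ (stirling₁ p j)) ((- 1ℚ) ^ j) (bernoulli (suc m +ℕ j)))

product-egf-β : ∀ p → expm1 ^ˢ suc p ⊛ egf (β p) ≗ closedForm p
product-egf-β = product-closedForm (λ p → egf (β p))
  (S.trans (⊛-comm expm1 (egf (β 0))) (S.trans (⊛-congˡ expm1 (λ n → cong (_÷! n) (β-zero n))) bernoulli-egf))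
  λ p n → begin
    egf (β (suc p)) n + D (egf (β p)) n             ≡⟨ cong (_+_ (egf (β (suc p)) n)) (D-egf (β p) n) ⟩
    (β (suc p) n ÷! n) + (β p (suc n) ÷! n)         ≡⟨ ℚ.*-distribʳ-+ _ (β (suc p) n) (β p (suc n)) ⟨
    (β (suc p) n + β p (suc n)) ÷! n                ≡⟨ cong (_÷! n) (β-suc p n) ⟩
    fromℕ p * β p n ÷! n                            ≡⟨ ℚ.*-assoc (fromℕ p) (β p n) _ ⟩
    fromℕ p * egf (β p) n                           ≡⟨ const-⊛ (fromℕ p) (egf (β p)) n ⟨
    (nat p ⊛ egf (β p)) n                           ∎

-- Coefficients of the closed form

coeff!-harmonicConv : ∀ p n → coeff! (harmonicConv p) n ≡ ∑[ j from 1 to p ] (stirling₂ n (p ∸ j) * harmonic j ÷! j)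
coeff!-harmonicConv p n = begin
  fromℕ (n !) * (egf harmonic ⊛ (λ k → divPower k n)) p
    ≡⟨ ⊛-scale (fromℕ (n !)) (egf harmonic) (λ k → divPower k n) p ⟨
  (egf harmonic ⊛ stirling₂ n) p
    -- The term j = 0 carries the factor H_0 = 0, so the sum starts at 1.
    ≡⟨ cong (_+ rest) (ℚ.*-zeroˡ (stirling₂ n p)) ⟩
  0ℚ + rest
    ≡⟨ ℚ.+-identityˡ rest ⟩
  rest
    ≡⟨ sum-cong-≗ {p} (λ i → trans (ℚ.*-comm (harmonic (suc (toℕ i)) ÷! suc (toℕ i)) (stirling₂ n (p ∸ suc (toℕ i))))
         (sym (ℚ.*-assoc (stirling₂ n (p ∸ suc (toℕ i))) (harmonic (suc (toℕ i))) _))) ⟩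
  ∑[ j from 1 to p ] (stirling₂ n (p ∸ j) * harmonic j ÷! j) ∎
  where
  rest = ∑[ i < p ] (egf harmonic (suc (toℕ i)) * stirling₂ n (p ∸ suc (toℕ i)))

-- Multiplication by t lowers the exponent of p by one and brings out the factor n+1; the harmonic
-- part keeps p^(n+1). The common factor pⁿ explains the exponent one below the degree.
coeff!-X-H-⊛ : ∀ p n → coeff! (X-H p ⊛ exp ^ˢ p) (suc n) ≡ fromℕ (p ^ℕ n) * (fromℕ (suc n) - fromℕ p * harmonic p)
coeff!-X-H-⊛ p n = begin
  fromℕ (suc n !) * ((0ℚ - H) * E (suc n) + (tail (X-H p) ⊛ E) n)
    ≡⟨ cong (λ x → fromℕ (suc n !) * ((0ℚ - H) * E (suc n) + x)) (S.trans (⊛-congˡ E tail-X-H) (S.*-identityˡ E) n) ⟩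
  fromℕ (suc n !) * ((0ℚ - H) * E (suc n) + E n)
    ≡⟨ solve 4 (λ f h u v → f :* ((con 0ℚ :- h) :* u :+ v) := :- h :* (f :* u) :+ f :* v) refl (fromℕ (suc n !)) H (E (suc n)) (E n) ⟩
  - H * coeff! E (suc n) + fromℕ (suc n !) * E n
    ≡⟨ cong₂ _+_ (cong (- H *_) (trans (coeff!-exp-^ˢ p (suc n)) (fromℕ-* p (p ^ℕ n))))
         (trans (cong (_* E n) (fromℕ-* (suc n) (n !))) (trans (ℚ.*-assoc (fromℕ (suc n)) (fromℕ (n !)) (E n)) (cong (fromℕ (suc n) *_) (coeff!-exp-^ˢ p n)))) ⟩
  - H * (fromℕ p * fromℕ (p ^ℕ n)) + fromℕ (suc n) * fromℕ (p ^ℕ n)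
    ≡⟨ solve 4 (λ h p q n → :- h :* (p :* q) :+ n :* q := q :* (n :- p :* h)) refl H (fromℕ p) (fromℕ (p ^ℕ n)) (fromℕ (suc n)) ⟩
  fromℕ (p ^ℕ n) * (fromℕ (suc n) - fromℕ p * H) ∎
  where
  E = exp ^ˢ p
  H = harmonic p

  tail-X-H : tail (X-H p) ≗ const 1ℚ
  tail-X-H k = ℚ.+-identityʳ (const 1ℚ k)

!-÷! : ∀ p → fromℕ (p !) * (1ℚ ÷! suc p) ≡ ℤ.+ 1 / suc p
!-÷! p = fromℕ-cancelˡ (suc p) (begin
  fromℕ (suc p) * (fromℕ (p !) * exp (suc p))  ≡⟨ solve 3 (λ a b c → a :* (b :* c) := b :* (a :* c)) refl (fromℕ (suc p)) (fromℕ (p !)) (exp (suc p)) ⟩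
  fromℕ (p !) * (fromℕ (suc p) * exp (suc p))  ≡⟨ cong (fromℕ (p !) *_) (exp-suc p) ⟩
  fromℕ (p !) * exp p                          ≡⟨ exp-inverse p ⟩
  1ℚ                                           ≡⟨ fromℕ-inverse (suc p) ⟨
  fromℕ (suc p) * (ℤ.+ 1 / suc p)              ∎)

coeff!-divPower-⊛ : ∀ p n → coeff! (divPower (suc p) ⊛ egf (β p)) (suc n)
  ≡ fromℕ (p ^ℕ n) * (fromℕ (suc n) - fromℕ p * harmonic p) ÷ℕ suc p
    + fromℕ (p !) ÷ℕ suc p * (∑[ j from 1 to p ] (stirling₂ (suc n) (p ∸ j) * harmonic j ÷! j))
coeff!-divPower-⊛ p n = begin
  f * (divPower (suc p) ⊛ egf (β p)) (suc n)
    ≡⟨ cong (f *_) (trans (scale-⊛ c (expm1 ^ˢ suc p) (egf (β p)) (suc n)) (cong (c *_) (product-egf-β p (suc n)))) ⟩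
  f * (c * closedForm p (suc n))
    ≡⟨ cong (λ x → f * (c * x)) (cong₂ _+_ (const-⊛ q (X-H p ⊛ exp ^ˢ p) (suc n))
         (trans (⊛-assoc (nat (p !)) (nat (p !)) (harmonicConv p) (suc n))
           (trans (const-⊛ q (nat (p !) ⊛ harmonicConv p) (suc n)) (cong (q *_) (const-⊛ q (harmonicConv p) (suc n)))))) ⟩
  f * (c * (q * u + q * (q * v)))
    -- One factor p! is paired with 1/(p+1)! to give 1/(p+1); the second one survives only in front
    -- of the harmonic sum.
    ≡⟨ solve 5 (λ f c q u v → f :* (c :* (q :* u :+ q :* (q :* v))) := f :* u :* (q :* c) :+ q :* (q :* c) :* (f :* v)) refl f c q u v ⟩
  f * u * (q * c) + q * (q * c) * (f * v)
    ≡⟨ cong₂ _+_ (cong₂ _*_ (coeff!-X-H-⊛ p n) (!-÷! p)) (cong₂ _*_ (cong (q *_) (!-÷! p)) (coeff!-harmonicConv p (suc n))) ⟩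
  fromℕ (p ^ℕ n) * (fromℕ (suc n) - fromℕ p * harmonic p) ÷ℕ suc p
    + fromℕ (p !) ÷ℕ suc p * (∑[ j from 1 to p ] (stirling₂ (suc n) (p ∸ j) * harmonic j ÷! j)) ∎
  where
  f = fromℕ (suc n !)
  c = 1ℚ ÷! suc p
  q = fromℕ (p !)
  u = (X-H p ⊛ exp ^ˢ p) (suc n)
  v = harmonicConv p (suc n)

corollary4 : ∀ (n p : ℕ) → p < n →
    ∑[ k from suc p to n ] ∑[ j from 0 to p ]
    (fromℕ (n C k) * stirling₂ k (suc p) * fromℕ (stirling₁ p j) * (- 1ℚ) ^ j * bernoulli (n +ℕ j ∸ k))
    ≡ fromℕ (p ^ℕ (n ∸ 1)) * (fromℕ n - fromℕ p * harmonic p) ÷ℕ suc p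
    + fromℕ (p !) ÷ℕ suc p * (∑[ j from 1 to p ] (stirling₂ n (p ∸ j) * harmonic j ÷! j))
corollary4 n@(suc n-1) p p<n = begin
  ∑[ k from suc p to n ] ∑[ j from 0 to p ]
    (fromℕ (n C k) * stirling₂ k (suc p) * fromℕ (stirling₁ p j) * (- 1ℚ) ^ j * bernoulli (n +ℕ j ∸ k))
    ≡⟨ ∑-range-cong (suc p) n (ℕ.m<n⇒m<1+n p<n) inner ⟩
  ∑[ k from suc p to n ] (fromℕ (n C k) * stirling₂ k (suc p) * β p (n ∸ k))
    -- The Stirling numbers vanish for k ≤ p, so the sum may start at 0 and becomes a full Cauchy
    -- product.
    ≡⟨ ∑-range-drop (suc p) n (λ k → fromℕ (n C k) * stirling₂ k (suc p) * β p (n ∸ k)) (ℕ.m<n⇒m<1+n p<n) vanish ⟩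
  ∑[ i ≤ n ] (fromℕ (n C toℕ i) * stirling₂ (toℕ i) (suc p) * β p (n ∸ toℕ i))
    ≡⟨ binomial-convolution (λ k → stirling₂ k (suc p)) (β p) n ⟩
  coeff! (egf (λ k → stirling₂ k (suc p)) ⊛ egf (β p)) n
    ≡⟨ cong (fromℕ (n !) *_) (⊛-congˡ (egf (β p)) (stirling₂-egf (suc p)) n) ⟩
  coeff! (divPower (suc p) ⊛ egf (β p)) n
    ≡⟨ coeff!-divPower-⊛ p n-1 ⟩
  _ ∎
  where
  inner : ∀ k → k ≤ n →
    ∑[ j from 0 to p ] (fromℕ (n C k) * stirling₂ k (suc p) * fromℕ (stirling₁ p j) * (- 1ℚ) ^ j * bernoulli (n +ℕ j ∸ k))
      ≡ fromℕ (n C k) * stirling₂ k (suc p) * β p (n ∸ k)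
  inner k k≤n = trans
    (sum-cong-≗ {suc p} λ i → trans
      (cong (λ m → fromℕ (n C k) * stirling₂ k (suc p) * fromℕ (stirling₁ p (toℕ i)) * (- 1ℚ) ^ toℕ i * bernoulli m)
        -- Truncated subtraction commutes with adding j because k ≤ n; the Bernoulli index becomes
        -- (n - k) + j, as in `β`.
        (ℕ.+-∸-comm (toℕ i) k≤n))
      (solve 4 (λ a s e b → a :* s :* e :* b := a :* (s :* (e :* b))) refl
        (fromℕ (n C k) * stirling₂ k (suc p)) (fromℕ (stirling₁ p (toℕ i))) ((- 1ℚ) ^ toℕ i) (bernoulli (n ∸ k +ℕ toℕ i))))
    (sym (*-distribˡ-sum {suc p} (fromℕ (n C k) * stirling₂ k (suc p))
      (λ j → fromℕ (stirling₁ p (toℕ j)) * ((- 1ℚ) ^ toℕ j * bernoulli (n ∸ k +ℕ toℕ j)))))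

  vanish : ∀ k → k < suc p → fromℕ (n C k) * stirling₂ k (suc p) * β p (n ∸ k) ≡ 0ℚ
  vanish k k<1+p = begin
    fromℕ (n C k) * stirling₂ k (suc p) * β p (n ∸ k)  ≡⟨ cong (λ x → fromℕ (n C k) * x * β p (n ∸ k)) (stirling₂-vanish k (suc p) k<1+p) ⟩
    fromℕ (n C k) * 0ℚ * β p (n ∸ k)                   ≡⟨ cong (_* β p (n ∸ k)) (ℚ.*-zeroʳ (fromℕ (n C k))) ⟩
    0ℚ * β p (n ∸ k)                                   ≡⟨ ℚ.*-zeroˡ (β p (n ∸ k)) ⟩
    0ℚ                                                 ∎
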